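{- Let $n\geq 4$ and let $P$ be a convex $n$-gon. If $T_1$ and $T_2$ are triangulations of $P$ whose sets of internal triangles coincide (i.e. the internal triangles of $T_1$ are exactly the internal triangles of $T_2$, as triangles with vertices among those of $P$), then the number of triangulations of $P$ disjoint from $T_1$ equals the number of triangulations of $P$ disjoint from $T_2$. In other words, the number of triangulations disjoint from a triangulation $T$ depends only on the position of the internal triangles of $T$.
   Context: A triangulation of a convex polygon $P$ uses non-crossing diagonals to divide $P$ into triangles. An internal triangle of a triangulation is one of its triangles that shares no side with $P$. Two triangulations of $P$ are disjoint if they have no diagonals in common. -}

module Defs where

open import Data.Nat.Base as ℕ using (ℕ; zero; suc; _*_)
import Data.Nat.Properties as ℕₚ
open import Data.Fin.Base using (Fin; toℕ; combine; _<_)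
open import Data.Fin.Properties using (all?; _<?_)
open import Data.Fin.Subset using (Subset; inside; outside; _∈_; _∩_; Empty; ∣_∣)
open import Data.Fin.Subset.Properties using (_∈?_; anySubset?; nonempty?)
open import Data.List.Base using (List; map; _++_; length; filter)
open import Data.Product.Base using (_×_; _,_)
open import Data.Sum.Base using (_⊎_)
open import Relation.Binary.Definitions as B using ()
open import Relation.Binary.PropositionalEquality.Core using (_≡_)
open import Relation.Nullary.Decidable using (Dec; ¬?; _×-dec_; _⊎-dec_; _→-dec_; map′; decidable-stable)
open import Relation.Nullary.Negation.Core using (¬_)
open import Relation.Unary using (Pred; Decidable)
import Data.List.Base as List
import Data.Vec.Base as Vec

allSubset? : ∀ {m ℓ} {P : Pred (Subset m) ℓ} → Decidable P → Dec (∀ S → P S)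
allSubset? P? = map′
  (λ ¬∃¬ S → decidable-stable (P? S) (λ ¬PS → ¬∃¬ (S , ¬PS)))
  (λ ∀P (S , ¬PS) → ¬PS (∀P S))
  (¬? (anySubset? (λ S → ¬? (P? S))))

subsets : ∀ m → List (Subset m)
subsets zero    = List.[ Vec.[] ]
subsets (suc m) = map (inside Vec.∷_) (subsets m) ++ map (outside Vec.∷_) (subsets m)

-- The vertices of the convex n-gon are 0 , 1 , … , n-1 in cyclic order. The
-- segment joining two distinct vertices is written as the pair i j with i < j.
module Polygon (n : ℕ) where

  Vertex : Set
  Vertex = Fin n

  Side : Vertex → Vertex → Set
  Side i j = i < j × (toℕ j ≡ suc (toℕ i) ⊎ (toℕ i ≡ 0 × suc (toℕ j) ≡ n))

  Diagonal : Vertex → Vertex → Set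
  Diagonal i j = i < j × ¬ Side i j

  -- For i < j and k < l: the open segments meet in exactly one point.
  Crossing : (i j k l : Vertex) → Set
  Crossing i j k l = (i < k × k < j × j < l) ⊎ (k < i × i < l × l < j)

  -- A set of pairs of vertices, the pair i j being coded by combine i j.
  SegmentSet : Set
  SegmentSet = Subset (n * n)

  Contains : SegmentSet → Vertex → Vertex → Set
  Contains D i j = combine i j ∈ D

  AllDiagonals : SegmentSet → Set
  AllDiagonals D = ∀ i j → Contains D i j → Diagonal i j

  NonCrossing : SegmentSet → Set
  NonCrossing D = ∀ i j → Contains D i j → ∀ k l → Contains D k l → ¬ Crossing i j k l

  -- For i < j in S: i and j are neighbours on the boundary of the convex hull
  -- of S, i.e. one of the two open boundary arcs of the n-gon between i and j
  -- contains no vertex of S.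
  Consecutive : Subset n → Vertex → Vertex → Set
  Consecutive S i j =
      (∀ k → k ∈ S → ¬ (i < k × k < j))
    ⊎ (∀ k → k ∈ S → ¬ (k < i ⊎ j < k))

  -- The convex hull of S is one of the regions into which the non-crossing set
  -- of diagonals D divides the n-gon: each of its sides is a side of the n-gon
  -- or belongs to D, and no member of D is a diagonal of it. (No further
  -- member of D can meet its interior without crossing one of its sides.)
  Region : SegmentSet → Subset n → Set
  Region D S =
      3 ℕ.≤ ∣ S ∣
    × (∀ i → i ∈ S → ∀ j → j ∈ S → i < j →
          (Consecutive S i j → Side i j ⊎ Contains D i j)
        × (Contains D i j → Consecutive S i j))

  Triangulation : SegmentSet → Set
  Triangulation D =
      AllDiagonals D
    × NonCrossing D
    × (∀ S → Region D S → ∣ S ∣ ≡ 3)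

  InternalTriangle : SegmentSet → Subset n → Set
  InternalTriangle T S =
      Region T S
    × ∣ S ∣ ≡ 3
    × (∀ i → i ∈ S → ∀ j → j ∈ S → ¬ Side i j)

  Disjoint : SegmentSet → SegmentSet → Set
  Disjoint T U = Empty (T ∩ U)

  side? : B.Decidable Side
  side? i j = (i <? j) ×-dec
    ((toℕ j ℕₚ.≟ suc (toℕ i)) ⊎-dec ((toℕ i ℕₚ.≟ 0) ×-dec (suc (toℕ j) ℕₚ.≟ n)))

  diagonal? : B.Decidable Diagonal
  diagonal? i j = (i <? j) ×-dec ¬? (side? i j)

  crossing? : ∀ i j k l → Dec (Crossing i j k l)
  crossing? i j k l =
          ((i <? k) ×-dec (k <? j) ×-dec (j <? l))
    ⊎-dec ((k <? i) ×-dec (i <? l) ×-dec (l <? j))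

  contains? : ∀ D i j → Dec (Contains D i j)
  contains? D i j = combine i j ∈? D

  allDiagonals? : Decidable AllDiagonals
  allDiagonals? D = all? λ i → all? λ j → contains? D i j →-dec diagonal? i j

  nonCrossing? : Decidable NonCrossing
  nonCrossing? D =
    all? λ i → all? λ j → contains? D i j →-dec
    (all? λ k → all? λ l → contains? D k l →-dec ¬? (crossing? i j k l))

  consecutive? : ∀ S i j → Dec (Consecutive S i j)
  consecutive? S i j =
          (all? λ k → (k ∈? S) →-dec ¬? ((i <? k) ×-dec (k <? j)))
    ⊎-dec (all? λ k → (k ∈? S) →-dec ¬? ((k <? i) ⊎-dec (j <? k)))

  region? : ∀ D S → Dec (Region D S)
  region? D S =
    (3 ℕₚ.≤? ∣ S ∣) ×-dec
    (all? λ i → (i ∈? S) →-dec (all? λ j → (j ∈? S) →-dec ((i <? j) →-dec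
      (   (consecutive? S i j →-dec (side? i j ⊎-dec contains? D i j))
    ×-dec (contains? D i j →-dec consecutive? S i j)))))

  triangulation? : Decidable Triangulation
  triangulation? D =
    allDiagonals? D ×-dec nonCrossing? D ×-dec
    (allSubset? λ S → region? D S →-dec (∣ S ∣ ℕₚ.≟ 3))

  disjoint? : B.Decidable Disjoint
  disjoint? T U = ¬? (nonempty? (T ∩ U))

  numDisjointTriangulations : SegmentSet → ℕ
  numDisjointTriangulations T =
    length (filter (λ U → triangulation? U ×-dec disjoint? T U) (subsets (n * n)))

{-# OPTIONS --safe #-}
module Submission where

-- Rooted at the side joining the first and the last vertex, a triangulation is a
-- binary tree: its leaves are the other sides, its non-leaf nodes other than the
-- root are the diagonals, and its internal triangles are the nodes other than the
-- root with two non-leaf children.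
--
-- Count the trees over a forest which avoid all edges of the forest. Those over
-- (… l r …) either avoid the edge that joins l and r or contain it, whence
--
--   #(… l r …) = #(… (node l r) …) + #(… leaf …) · #(l r).
--
-- Consequently every tree acts on sequences of integers as a polynomial in the
-- shift operator. These operators commute, so that the children of a node can be
-- exchanged, and a node with a leaf child can be moved from one side of the root
-- to the other. So only the branching nodes and the numbers of non-branching nodes
-- between them matter, and the positions of the internal triangles determine both.

open import Defs
open import Data.Nat.Base using (ℕ; _≤_)
open import Data.Fin.Subset using (Subset)
open import Function.Bundles using (_⇔_)
open import Relation.Binary.PropositionalEquality.Core using (_≡_)

-- Solved for `node l r`, the recurrence removes one node at the price of a subtraction, until only
-- leaves remain. Hence the integers, and hence an operator which needs to know only the number `m`
-- of leaves in front of a tree. The multiplier #(l r) is itself a value of such operators, so the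
-- recursion closes.
--
-- The obstacle is the root. Its triangle contains the rooting side, so it is never internal, and
-- its third vertex is not determined by the internal triangles. Two triangulations to be compared
-- may place this vertex differently, even so that all internal triangles lie to the right of it in
-- one and to the left of it in the other. Below the root, exchanging children is enough for a
-- normal form. Across the root, nodes with a leaf child must be moved as well, after which only the
-- total number of leaves matters.
--
-- The lengths of the chains of non-branching nodes need not be recorded: a branching node and its
-- two children span known intervals of vertices, so each length is a difference of widths.

module Forests where

  open import Data.Nat.Base
  open import Data.Nat.Properties
  open import Data.Nat.Tactic.RingSolver using (solve-∀)
  open import Data.List.Base using (List; []; _∷_; [_]; _++_; map; concatMap; length; cartesianProductWith)
  open import Data.List.Properties using (cartesianProductWith-zeroʳ; map-++; map-∘; map-cong; length-++; length-map; ++-assoc)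
  open import Data.Nat.ListAction using (sum)
  open import Data.Nat.ListAction.Properties using (sum-++)
  open import Data.List.Relation.Unary.All as All using (All; []; _∷_)
  import Data.List.Relation.Unary.All.Properties as Allₚ
  open import Data.Product.Base using (_×_; _,_; proj₁; proj₂)
  open import Function.Base using (_∘_)
  open import Relation.Binary.PropositionalEquality hiding ([_])

  -- Trees, cuts of forests, and the recurrence for the number of avoiding trees.

  data Tree : Set where
    leaf : Tree
    node : Tree → Tree → Tree

  Forest : Set
  Forest = List Tree

  leaves : Tree → ℕ
  leaves leaf       = 1
  leaves (node l r) = leaves l + leaves r

  width : Forest → ℕ
  width []       = 0
  width (t ∷ ts) = leaves t + width ts

  leaves≥1 : ∀ t → 1 ≤ leaves t
  leaves≥1 leaf       = ≤-refl
  leaves≥1 (node l r) = ≤-trans (leaves≥1 l) (m≤m+n _ _)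

  width-++ : ∀ us vs → width (us ++ vs) ≡ width us + width vs
  width-++ []       vs = refl
  width-++ (u ∷ us) vs = trans (cong (leaves u +_) (width-++ us vs)) (sym (+-assoc (leaves u) _ _))

  Cut : Set
  Cut = Forest × Forest

  _▸_ : Cut → Forest → Cut
  (u , v) ▸ ts = u , v ++ ts

  _◂_ : Forest → Cut → Cut
  ts ◂ (u , v) = ts ++ u , v

  innerCuts : Tree → List Cut
  innerCuts leaf       = []
  innerCuts (node l r) =
    map (_▸ [ r ]) (innerCuts l) ++ ([ l ] , [ r ]) ∷ map ([ l ] ◂_) (innerCuts r)

  -- The cuts of a forest at the vertices after its left end, from left to right.
  -- The last of them is the trivial cut (ts , []); it costs nothing, because no
  -- tree lies over the empty forest.
  cuts : Forest → List Cut
  cuts []       = []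
  cuts (t ∷ ts) = map (_▸ ts) (innerCuts t) ++ ([ t ] , ts) ∷ map ([ t ] ◂_) (cuts ts)

  leafOnly : Tree → List Tree
  leafOnly leaf       = [ leaf ]
  leafOnly (node _ _) = []

  -- For fuel at least width ts, these are the trees over ts none of whose
  -- non-leaf nodes spans the same leaves as a non-leaf node of ts.
  avoiders : ℕ → Forest → List Tree
  avoiders f       []                = []
  avoiders f       (t ∷ [])          = leafOnly t
  avoiders zero    (s ∷ t ∷ ts)      = []
  avoiders (suc f) (s ∷ t ∷ ts)      =
    concatMap (λ (u , v) → cartesianProductWith node (avoiders f u) (avoiders f v)) (cuts (s ∷ t ∷ ts))

  -- Only the left part is required to be nonempty, because the trivial cut has an empty right part.
  IsCut : ℕ → Cut → Set
  IsCut w (u , v) = 1 ≤ width u × width u + width v ≡ w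

  IsInnerCut : ℕ → Cut → Set
  IsInnerCut w (u , v) = 1 ≤ width v × IsCut w (u , v)

  ▸-isCut : ∀ {w} ts c → IsCut w c → IsCut (w + width ts) (c ▸ ts)
  ▸-isCut {w} ts (u , v) (p , q) = p , (begin
    width u + width (v ++ ts)       ≡⟨ cong (width u +_) (width-++ v ts) ⟩
    width u + (width v + width ts)  ≡⟨ +-assoc (width u) _ _ ⟨
    width u + width v + width ts    ≡⟨ cong (_+ width ts) q ⟩
    w + width ts                    ∎)
    where open ≡-Reasoning

  ◂-isCut : ∀ {w} t c → IsCut w c → IsCut (leaves t + w) ([ t ] ◂ c)
  ◂-isCut t (u , v) (p , q) =
    ≤-trans (leaves≥1 t) (m≤m+n _ _) , trans (+-assoc (leaves t) _ _) (cong (leaves t +_) q)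

  singleton-width : ∀ t → width [ t ] ≡ leaves t
  singleton-width t = +-identityʳ (leaves t)

  singleton-isCut : ∀ t ts → IsCut (leaves t + width ts) ([ t ] , ts)
  singleton-isCut t ts =
    ≤-trans (leaves≥1 t) (m≤m+n _ _) , cong (_+ width ts) (singleton-width t)

  innerCuts-isCut : ∀ t → All (IsInnerCut (leaves t)) (innerCuts t)
  innerCuts-isCut leaf       = []
  innerCuts-isCut (node l r) = Allₚ.++⁺
    (Allₚ.map⁺ (All.map (λ {c} (p , q) →
        subst (1 ≤_) (sym (width-++ (proj₂ c) [ r ])) (≤-trans p (m≤m+n _ _)) ,
        subst (λ k → IsCut k (c ▸ [ r ])) (cong (leaves l +_) (singleton-width r)) (▸-isCut [ r ] c q))
      (innerCuts-isCut l)))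
    ((≤-trans (leaves≥1 r) (m≤m+n _ _) ,
      subst (λ k → IsCut (leaves l + k) ([ l ] , [ r ])) (singleton-width r) (singleton-isCut l [ r ])) ∷
     Allₚ.map⁺ (All.map (λ {c} (p , q) → p , ◂-isCut l c q) (innerCuts-isCut r)))

  cuts-isCut : ∀ ts → All (IsCut (width ts)) (cuts ts)
  cuts-isCut []       = []
  cuts-isCut (t ∷ ts) = Allₚ.++⁺
    (Allₚ.map⁺ (All.map (λ {c} (_ , q) → ▸-isCut ts c q) (innerCuts-isCut t)))
    (singleton-isCut t ts ∷ Allₚ.map⁺ (All.map (λ {c} → ◂-isCut t c) (cuts-isCut ts)))

  cut-left< : ∀ {w} u t v → IsCut w (u , t ∷ v) → width u < w
  cut-left< u t v (_ , q) = subst (width u <_) q (m<m+n (width u) (≤-trans (leaves≥1 t) (m≤m+n _ _)))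

  cut-right< : ∀ {w} u v → IsCut w (u , v) → width v < w
  cut-right< u v (p , q) = subst (width v <_) q (m<n+m (width v) p)

  concatMap-cong-local : ∀ {A B : Set} {f h : A → List B} {xs} →
    All (λ x → f x ≡ h x) xs → concatMap f xs ≡ concatMap h xs
  concatMap-cong-local []       = refl
  concatMap-cong-local (e ∷ es) = cong₂ _++_ e (concatMap-cong-local es)

  -- A nontrivial cut makes both parts narrower than the forest, so one unit of fuel per level
  -- suffices.
  avoiders-fuel : ∀ f f′ ts → width ts ≤ f → width ts ≤ f′ → avoiders f ts ≡ avoiders f′ ts
  avoiders-fuel f f′ []              p q = refl
  avoiders-fuel f f′ (t ∷ [])        p q = refl
  avoiders-fuel zero f′ (s ∷ t ∷ ts) p q with () ← ≤-trans (leaves≥1 s) (≤-trans (m≤m+n _ _) p)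
  avoiders-fuel (suc f) zero (s ∷ t ∷ ts) p q with () ← ≤-trans (leaves≥1 s) (≤-trans (m≤m+n _ _) q)
  avoiders-fuel (suc f) (suc f′) ts@(_ ∷ _ ∷ _) p q =
    concatMap-cong-local {xs = cuts ts} (All.map (λ {c} → step c) (cuts-isCut ts))
    where
    step : ∀ c → IsCut (width ts) c →
      cartesianProductWith node (avoiders f (proj₁ c)) (avoiders f (proj₂ c)) ≡
      cartesianProductWith node (avoiders f′ (proj₁ c)) (avoiders f′ (proj₂ c))
    -- Here `u` is the whole forest and the fuel may be too small for it, but the empty right part
    -- makes both products empty.
    step (u , [])    ic = trans (cartesianProductWith-zeroʳ node (avoiders f u))
      (sym (cartesianProductWith-zeroʳ node (avoiders f′ u)))
    step (u , t ∷ v) ic = cong₂ (cartesianProductWith node)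
      (avoiders-fuel f f′ u (s≤s⁻¹ (≤-trans (cut-left< u t v ic) p)) (s≤s⁻¹ (≤-trans (cut-left< u t v ic) q)))
      (avoiders-fuel f f′ (t ∷ v) (s≤s⁻¹ (≤-trans (cut-right< u (t ∷ v) ic) p)) (s≤s⁻¹ (≤-trans (cut-right< u (t ∷ v) ic) q)))

  numAvoiders : Forest → ℕ
  numAvoiders ts = length (avoiders (width ts) ts)

  sumOver : ∀ {A : Set} → List A → (A → ℕ) → ℕ
  sumOver xs f = sum (map f xs)

  sumOver-++ : ∀ {A : Set} (xs ys : List A) f → sumOver (xs ++ ys) f ≡ sumOver xs f + sumOver ys f
  sumOver-++ xs ys f = trans (cong sum (map-++ f xs ys)) (sum-++ (map f xs) (map f ys))

  sumOver-map : ∀ {A B : Set} (h : A → B) xs f → sumOver (map h xs) f ≡ sumOver xs (f ∘ h)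
  sumOver-map h xs f = cong sum (sym (map-∘ xs))

  sumOver-cong : ∀ {A : Set} {f h : A → ℕ} (xs : List A) → (∀ x → f x ≡ h x) → sumOver xs f ≡ sumOver xs h
  sumOver-cong xs e = cong sum (map-cong e xs)

  sumOver-linear : ∀ {A : Set} {e f h : A → ℕ} q {xs : List A} →
    All (λ x → e x ≡ f x + h x * q) xs → sumOver xs e ≡ sumOver xs f + sumOver xs h * q
  sumOver-linear q [] = refl
  sumOver-linear {f = f} {h} q {x ∷ xs} (p ∷ ps) =
    trans (cong₂ _+_ p (sumOver-linear q ps)) (lemma (f x) (h x) (sumOver xs f) (sumOver xs h) q)
    where
    lemma : ∀ a b c d q → (a + b * q) + (c + d * q) ≡ (a + c) + (b + d) * q
    lemma = solve-∀

  length-concatMap : ∀ {A B : Set} (f : A → List B) xs → length (concatMap f xs) ≡ sumOver xs (length ∘ f)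
  length-concatMap f []       = refl
  length-concatMap f (x ∷ xs) = trans (length-++ (f x)) (cong (length (f x) +_) (length-concatMap f xs))

  sumOver-cong-local : ∀ {A : Set} {f h : A → ℕ} {xs : List A} → All (λ x → f x ≡ h x) xs → sumOver xs f ≡ sumOver xs h
  sumOver-cong-local []       = refl
  sumOver-cong-local (e ∷ es) = cong₂ _+_ e (sumOver-cong-local es)

  length-cartesianProductWith : ∀ {A B C : Set} (f : A → B → C) xs ys →
    length (cartesianProductWith f xs ys) ≡ length xs * length ys
  length-cartesianProductWith f []       ys = refl
  length-cartesianProductWith f (x ∷ xs) ys =
    trans (length-++ (map (f x) ys)) (cong₂ _+_ (length-map (f x) ys) (length-cartesianProductWith f xs ys))

  cutProduct : Cut → ℕ
  cutProduct (u , v) = numAvoiders u * numAvoiders v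

  numAvoiders-cuts : ∀ ts → 2 ≤ length ts → numAvoiders ts ≡ sumOver (cuts ts) cutProduct
  numAvoiders-cuts (_ ∷ []) (s≤s ())
  numAvoiders-cuts ts@(s ∷ t ∷ ts′) _ = begin
    numAvoiders ts                       ≡⟨ cong length (avoiders-fuel (width ts) (suc w) ts ≤-refl (n≤1+n w)) ⟩
    length (concatMap pairs (cuts ts))   ≡⟨ length-concatMap pairs (cuts ts) ⟩
    sumOver (cuts ts) (length ∘ pairs)   ≡⟨ sumOver-cong-local {xs = cuts ts} (All.map (λ {c} → step c) (cuts-isCut ts)) ⟩
    sumOver (cuts ts) cutProduct                 ∎
    where
    open ≡-Reasoning
    w = width ts
    pairs : Cut → List Tree
    pairs (u , v) = cartesianProductWith node (avoiders w u) (avoiders w v)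
    step : ∀ c → IsCut w c → length (pairs c) ≡ cutProduct c
    step (u , v) ic = trans (length-cartesianProductWith node (avoiders w u) (avoiders w v)) (cong₂ (λ x y → length x * length y)
      (avoiders-fuel w (width u) u (≤-trans (m≤m+n _ _) (≤-reflexive (proj₂ ic))) ≤-refl)
      (avoiders-fuel w (width v) v (<⇒≤ (cut-right< u v ic)) ≤-refl))

  cutSum : (Cut → ℕ) → Forest → ℕ
  cutSum f ts = sumOver (cuts ts) f

  innerSum : (Cut → ℕ) → Tree → ℕ
  innerSum f t = sumOver (innerCuts t) f

  cutSum-∷ : ∀ f t ts →
    cutSum f (t ∷ ts) ≡ innerSum (f ∘ (_▸ ts)) t + (f ([ t ] , ts) + cutSum (f ∘ ([ t ] ◂_)) ts)
  cutSum-∷ f t ts = trans (sumOver-++ (map (_▸ ts) (innerCuts t)) _ f)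
    (cong₂ _+_ (sumOver-map (_▸ ts) (innerCuts t) f) (cong (f ([ t ] , ts) +_) (sumOver-map ([ t ] ◂_) (cuts ts) f)))

  innerSum-node : ∀ f l r →
    innerSum f (node l r) ≡ innerSum (f ∘ (_▸ [ r ])) l + (f ([ l ] , [ r ]) + innerSum (f ∘ ([ l ] ◂_)) r)
  innerSum-node f l r = trans (sumOver-++ (map (_▸ [ r ]) (innerCuts l)) _ f)
    (cong₂ _+_ (sumOver-map (_▸ [ r ]) (innerCuts l) f) (cong (f ([ l ] , [ r ]) +_) (sumOver-map ([ l ] ◂_) (innerCuts r) f)))

  cutSum-++ : ∀ f us vs →
    cutSum f (us ++ vs) ≡ cutSum (f ∘ (_▸ vs)) us + cutSum (f ∘ (us ◂_)) vs
  cutSum-++ f []       vs = refl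
  cutSum-++ f (u ∷ us) vs = begin
    cutSum f (u ∷ us ++ vs)
      ≡⟨ cutSum-∷ f u (us ++ vs) ⟩
    innerSum (f ∘ (_▸ (us ++ vs))) u + (f ([ u ] , us ++ vs) + cutSum (f ∘ ([ u ] ◂_)) (us ++ vs))
      ≡⟨ cong₂ _+_ (sumOver-cong (innerCuts u) (λ (x , y) → cong (λ z → f (x , z)) (sym (++-assoc y us vs))))
                   (cong (f ([ u ] , us ++ vs) +_) (cutSum-++ (f ∘ ([ u ] ◂_)) us vs)) ⟩
    innerSum (f′ ∘ (_▸ us)) u + (f ([ u ] , us ++ vs) + (cutSum (f′ ∘ ([ u ] ◂_)) us + rest))
      ≡⟨ lemma (innerSum (f′ ∘ (_▸ us)) u) (f ([ u ] , us ++ vs)) (cutSum (f′ ∘ ([ u ] ◂_)) us) rest ⟩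
    innerSum (f′ ∘ (_▸ us)) u + (f ([ u ] , us ++ vs) + cutSum (f′ ∘ ([ u ] ◂_)) us) + rest
      ≡⟨ cong (_+ rest) (cutSum-∷ f′ u us) ⟨
    cutSum f′ (u ∷ us) + rest ∎
    where
    open ≡-Reasoning
    f′ = f ∘ (_▸ vs)
    rest = cutSum (f ∘ ((u ∷ us) ◂_)) vs
    lemma : ∀ a b c d → a + (b + (c + d)) ≡ a + (b + c) + d
    lemma = solve-∀

  -- Induction on the width, comparing the cuts of the three forests. A cut strictly inside the span
  -- of `l` and `r` (`straddling`) gives the same parts whether or not they are joined, and `leaf`
  -- has no such cut. Any other cut (`outside`) leaves `l` and `r` together in one part, to which
  -- the induction hypothesis applies.
  numAvoiders-split-≤ : ∀ n us l r vs → width (us ++ l ∷ r ∷ vs) ≤ n →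
    numAvoiders (us ++ l ∷ r ∷ vs) ≡ numAvoiders (us ++ node l r ∷ vs) + numAvoiders (us ++ leaf ∷ vs) * numAvoiders (l ∷ r ∷ [])

  private
    straddling : Forest → Tree → Tree → Forest → ℕ
    straddling us l r vs =
        innerSum (λ (x , y) → cutProduct (us ++ x , y ++ r ∷ vs)) l
      + (cutProduct (us ++ [ l ] , r ∷ vs) + innerSum (λ (x , y) → cutProduct (us ++ l ∷ x , y ++ vs)) r)

    outside : Forest → Forest → Forest → ℕ
    outside us ms vs = cutSum (λ (x , y) → cutProduct (x , y ++ ms ++ vs)) us
      + (cutProduct (us ++ ms , vs) + cutSum (λ (x , y) → cutProduct (us ++ ms ++ x , y)) vs)

    cutSum-pair : ∀ us l r vs →
      cutSum cutProduct (us ++ l ∷ r ∷ vs) ≡ straddling us l r vs + outside us (l ∷ r ∷ []) vs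
    cutSum-pair us l r vs = begin
      cutSum cutProduct (us ++ l ∷ r ∷ vs)
        ≡⟨ cutSum-++ cutProduct us (l ∷ r ∷ vs) ⟩
      A + cutSum (cutProduct ∘ (us ◂_)) (l ∷ r ∷ vs)
        ≡⟨ cong (A +_) (trans (cutSum-∷ (cutProduct ∘ (us ◂_)) l (r ∷ vs))
             (cong (λ z → B + (D + z)) (cutSum-∷ _ r vs))) ⟩
      A + (B + (D + (E + (F + G))))
        ≡⟨ lemma A B D E F G ⟩
      straddling us l r vs + outside us (l ∷ r ∷ []) vs ∎
      where
      open ≡-Reasoning
      A = cutSum (λ (x , y) → cutProduct (x , y ++ l ∷ r ∷ vs)) us
      B = innerSum (λ (x , y) → cutProduct (us ++ x , y ++ r ∷ vs)) l
      D = cutProduct (us ++ [ l ] , r ∷ vs)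
      E = innerSum (λ (x , y) → cutProduct (us ++ l ∷ x , y ++ vs)) r
      F = cutProduct (us ++ l ∷ r ∷ [] , vs)
      G = cutSum (λ (x , y) → cutProduct (us ++ l ∷ r ∷ x , y)) vs
      lemma : ∀ a b d e f h → a + (b + (d + (e + (f + h)))) ≡ (b + (d + e)) + (a + (f + h))
      lemma = solve-∀

    cutSum-node : ∀ us l r vs →
      cutSum cutProduct (us ++ node l r ∷ vs) ≡ straddling us l r vs + outside us [ node l r ] vs
    cutSum-node us l r vs = begin
      cutSum cutProduct (us ++ node l r ∷ vs)
        ≡⟨ cutSum-++ cutProduct us (node l r ∷ vs) ⟩
      A + cutSum (cutProduct ∘ (us ◂_)) (node l r ∷ vs)
        ≡⟨ cong (A +_) (trans (cutSum-∷ (cutProduct ∘ (us ◂_)) (node l r) vs)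
             (cong (_+ (F + G)) (trans (innerSum-node _ l r)
               (cong (_+ (D + E)) (sumOver-cong (innerCuts l)
                 (λ (x , y) → cong (λ z → cutProduct (us ++ x , z)) (++-assoc y [ r ] vs))))))) ⟩
      A + ((B + (D + E)) + (F + G))
        ≡⟨ lemma A (B + (D + E)) (F + G) ⟩
      straddling us l r vs + outside us [ node l r ] vs ∎
      where
      open ≡-Reasoning
      A = cutSum (λ (x , y) → cutProduct (x , y ++ node l r ∷ vs)) us
      B = innerSum (λ (x , y) → cutProduct (us ++ x , y ++ r ∷ vs)) l
      D = cutProduct (us ++ [ l ] , r ∷ vs)
      E = innerSum (λ (x , y) → cutProduct (us ++ l ∷ x , y ++ vs)) r
      F = cutProduct (us ++ [ node l r ] , vs)
      G = cutSum (λ (x , y) → cutProduct (us ++ node l r ∷ x , y)) vs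
      lemma : ∀ a b c → a + (b + c) ≡ b + (a + c)
      lemma = solve-∀

    cutSum-leaf : ∀ us vs → cutSum cutProduct (us ++ leaf ∷ vs) ≡ outside us [ leaf ] vs
    cutSum-leaf us vs = trans (cutSum-++ cutProduct us (leaf ∷ vs))
      (cong (cutSum (cutProduct ∘ (_▸ (leaf ∷ vs))) us +_) (cutSum-∷ (cutProduct ∘ (us ◂_)) leaf vs))

    module _ {n} (us : Forest) (l r : Tree) (vs : Forest) (w≤ : width (us ++ l ∷ r ∷ vs) ≤ suc n) where

      q : ℕ
      q = numAvoiders (l ∷ r ∷ [])

      w≤′ : width us + (leaves l + (leaves r + width vs)) ≤ suc n
      w≤′ = subst (_≤ suc n) (width-++ us (l ∷ r ∷ vs)) w≤

      left-terms : ∀ c → IsCut (width us) c →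
        cutProduct (c ▸ (l ∷ r ∷ vs)) ≡ cutProduct (c ▸ (node l r ∷ vs)) + cutProduct (c ▸ (leaf ∷ vs)) * q
      left-terms (x , y) (p , e) =
        trans (cong (numAvoiders x *_) (numAvoiders-split-≤ n y l r vs bound)) (lemma (numAvoiders x) _ _ q)
        where
        lemma : ∀ a b c d → a * (b + c * d) ≡ a * b + a * c * d
        lemma = solve-∀
        bound : width (y ++ l ∷ r ∷ vs) ≤ n
        bound = s≤s⁻¹ (≤-trans (subst (λ z → suc z ≤ width us + (leaves l + (leaves r + width vs)))
                  (sym (width-++ y (l ∷ r ∷ vs))) (+-monoˡ-≤ _ (cut-right< x y (p , e)))) w≤′)

      right-terms : ∀ x y → width x + width y ≡ width vs →
        cutProduct (us ++ l ∷ r ∷ x , y) ≡ cutProduct (us ++ node l r ∷ x , y) + cutProduct (us ++ leaf ∷ x , y) * q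
      -- The trivial cut does not reduce the width, so there is no induction hypothesis; all three
      -- products vanish instead.
      right-terms x [] e = lemma (numAvoiders (us ++ l ∷ r ∷ x)) (numAvoiders (us ++ node l r ∷ x)) (numAvoiders (us ++ leaf ∷ x)) q
        where
        lemma : ∀ a b c q → a * 0 ≡ b * 0 + c * 0 * q
        lemma = solve-∀
      right-terms x y@(t ∷ y′) e =
        trans (cong (_* numAvoiders y) (numAvoiders-split-≤ n us l r x bound))
          (lemma (numAvoiders (us ++ node l r ∷ x)) (numAvoiders (us ++ leaf ∷ x)) (numAvoiders y) q)
        where
        lemma : ∀ b c y d → (b + c * d) * y ≡ b * y + c * y * d
        lemma = solve-∀
        bound : width (us ++ l ∷ r ∷ x) ≤ n
        bound = s≤s⁻¹ (≤-trans (subst (λ z → suc z ≤ width us + (leaves l + (leaves r + width vs)))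
                  (sym (width-++ us (l ∷ r ∷ x)))
                  (+-monoʳ-< (width us) (+-monoʳ-< (leaves l) (+-monoʳ-< (leaves r)
                    (subst (width x <_) e (m<m+n (width x) (≤-trans (leaves≥1 t) (m≤m+n _ _)))))))) w≤′)

      outside-split : outside us (l ∷ r ∷ []) vs ≡ outside us [ node l r ] vs + outside us [ leaf ] vs * q
      outside-split = trans
        (cong₂ _+_ (sumOver-linear q {cuts us} (All.map (λ {c} → left-terms c) (cuts-isCut us)))
          (cong₂ _+_ (right-terms [] vs refl)
            (sumOver-linear q {cuts vs} (All.map (λ {(x , y)} (_ , e) → right-terms x y e) (cuts-isCut vs)))))
        (lemma (sumOver (cuts us) _) (sumOver (cuts us) _) (cutProduct (us ++ [ node l r ] , vs))
               (cutProduct (us ++ [ leaf ] , vs)) (sumOver (cuts vs) _) (sumOver (cuts vs) _) q)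
        where
        lemma : ∀ a a′ b b′ c c′ q →
          (a + a′ * q) + ((b + b′ * q) + (c + c′ * q)) ≡ (a + (b + c)) + (a′ + (b′ + c′)) * q
        lemma = solve-∀

      split-step : 2 ≤ length (us ++ node l r ∷ vs) → 2 ≤ length (us ++ leaf ∷ vs) →
        2 ≤ length (us ++ l ∷ r ∷ vs) →
        numAvoiders (us ++ l ∷ r ∷ vs) ≡ numAvoiders (us ++ node l r ∷ vs) + numAvoiders (us ++ leaf ∷ vs) * q
      split-step a b c = begin
        numAvoiders (us ++ l ∷ r ∷ vs)
          ≡⟨ trans (numAvoiders-cuts (us ++ l ∷ r ∷ vs) c) (cutSum-pair us l r vs) ⟩
        straddling us l r vs + outside us (l ∷ r ∷ []) vs
          ≡⟨ cong (straddling us l r vs +_) outside-split ⟩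
        straddling us l r vs + (outside us [ node l r ] vs + outside us [ leaf ] vs * q)
          ≡⟨ +-assoc (straddling us l r vs) _ _ ⟨
        straddling us l r vs + outside us [ node l r ] vs + outside us [ leaf ] vs * q
          ≡⟨ cong₂ (λ x y → x + y * q) (trans (numAvoiders-cuts (us ++ node l r ∷ vs) a) (cutSum-node us l r vs))
                                       (trans (numAvoiders-cuts (us ++ leaf ∷ vs) b) (cutSum-leaf us vs)) ⟨
        numAvoiders (us ++ node l r ∷ vs) + numAvoiders (us ++ leaf ∷ vs) * q ∎
        where open ≡-Reasoning

  numAvoiders-split-≤ zero us l r vs w≤ with () ←
    ≤-trans (≤-trans (leaves≥1 l) (m≤m+n _ _)) (≤-trans (m≤n+m (width (l ∷ r ∷ vs)) (width us))
      (subst (_≤ 0) (width-++ us (l ∷ r ∷ vs)) w≤))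
  -- The cut formula needs two trees. Here nothing avoids the single node and one tree avoids the
  -- single leaf, so the claim reads q = 0 + 1 * q.
  numAvoiders-split-≤ (suc n) []       l r [] w≤ = sym (+-identityʳ _)
  numAvoiders-split-≤ (suc n) []       l r vs@(_ ∷ _) w≤ =
    split-step [] l r vs w≤ (s≤s (s≤s z≤n)) (s≤s (s≤s z≤n)) (s≤s (s≤s z≤n))
  numAvoiders-split-≤ (suc n) us@(u ∷ us′) l r vs w≤ =
    split-step us l r vs w≤ (s≤s (long (node l r) vs)) (s≤s (long leaf vs)) (s≤s (long l (r ∷ vs)))
    where
    long : ∀ t ts → 1 ≤ length (us′ ++ t ∷ ts)
    long t ts = subst (1 ≤_) (sym (length-++ us′)) (≤-trans (s≤s z≤n) (m≤n+m _ (length us′)))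

  numAvoiders-split : ∀ us l r vs →
    numAvoiders (us ++ l ∷ r ∷ vs) ≡ numAvoiders (us ++ node l r ∷ vs) + numAvoiders (us ++ leaf ∷ vs) * numAvoiders (l ∷ r ∷ [])
  numAvoiders-split us l r vs = numAvoiders-split-≤ _ us l r vs ≤-refl

-- Trees as commuting operators on integer sequences.

module Operators where

  open Forests
  open import Data.Nat.Base as ℕ using (ℕ; zero; suc)
  import Data.Nat.Properties as ℕₚ
  open import Data.Integer.Base using (ℤ; +_; _+_; _-_; _*_)
  open import Data.Integer.Properties using (pos-+; pos-*)
  import Data.Integer.Tactic.RingSolver as ℤ-Solver
  open import Data.List.Base using (List; []; _∷_; _++_; replicate)
  open import Data.List.Properties using (++-identityʳ)
  open import Function.Base using (_∘_)
  open import Relation.Binary.PropositionalEquality hiding ([_])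

  Seq : Set
  Seq = ℕ → ℤ

  -- Leaves forbid nothing, so for positive `m` this is the Catalan number with index m - 1; at 0 it
  -- is 0.
  catalan : Seq
  catalan m = + numAvoiders (replicate m leaf)

  -- If f m is the number of trees avoiding m leaves followed by a fixed forest,
  -- then L t f m is that number with t inserted in front of this forest.
  L : Tree → Seq → Seq
  L leaf       f m = f (suc m)
  L (node l r) f m = L l (L r f) m - L l (L r catalan) 0 * f (suc m)

  L-cong : ∀ t {f h : Seq} → (∀ k → f k ≡ h k) → ∀ m → L t f m ≡ L t h m
  L-cong leaf       e m = e (suc m)
  L-cong (node l r) e m =
    cong₂ (λ x y → x - L l (L r catalan) 0 * y) (L-cong l (L-cong r e) m) (e (suc m))

  L-linear : ∀ t (f h : Seq) c m → L t (λ k → f k - c * h k) m ≡ L t f m - c * L t h m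
  L-linear leaf       f h c m = refl
  L-linear (node l r) f h c m = trans
    (cong (_- L l (L r catalan) 0 * (f (suc m) - c * h (suc m)))
      (trans (L-cong l (L-linear r f h c) m) (L-linear l (L r f) (L r h) c m)))
    (identity (L l (L r f) m) (L l (L r h) m) c (L l (L r catalan) 0) (f (suc m)) (h (suc m)))
    where
    identity : ∀ a b c n x y → (a - c * b) - n * (x - c * y) ≡ (a - n * x) - c * (b - n * y)
    identity = ℤ-Solver.solve-∀

  L-shift : ∀ t (f : Seq) m → L t (f ∘ suc) m ≡ L t f (suc m)
  L-shift leaf       f m = refl
  L-shift (node l r) f m = cong (_- L l (L r catalan) 0 * f (suc (suc m)))
    (trans (L-cong l (L-shift r f) m) (L-shift l (L r f) m))

  -- `L s` is built from the shift by composition, scaling and subtraction, and `L t` respects all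
  -- three because it is linear and commutes with the shift. Induction on `s` alone is therefore
  -- enough.
  L-comm : ∀ s t (f : Seq) m → L s (L t f) m ≡ L t (L s f) m
  L-comm leaf       t f m = sym (L-shift t f m)
  L-comm (node l r) t f m = begin
    L l (L r (L t f)) m - n * L t f (suc m)
      ≡⟨ cong₂ (λ x y → x - n * y)
           (trans (L-cong l (L-comm r t f) m) (L-comm l t (L r f) m)) (sym (L-shift t f m)) ⟩
    L t (L l (L r f)) m - n * L t (f ∘ suc) m
      ≡⟨ L-linear t (L l (L r f)) (f ∘ suc) n m ⟨
    L t (L (node l r) f) m ∎
    where
    open ≡-Reasoning
    n = L l (L r catalan) 0

  -- By `numAvoiders-β` this is the number of trees over the two-tree forest `s`, `t` that avoid it,
  -- which is the count wanted for the triangulation with tree `node s t`.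
  β : Tree → Tree → ℤ
  β s t = L s (L t catalan) 0

  β-comm : ∀ s t → β s t ≡ β t s
  β-comm s t = L-comm s t catalan 0

  infix 4 _≈_
  -- Equality of the actions; the record allows both trees to be inferred from a proof.
  record _≈_ (s t : Tree) : Set where
    constructor mk≈
    field L-≡ : ∀ f m → L s f m ≡ L t f m
  open _≈_ public

  ≈-refl : ∀ {t} → t ≈ t
  ≈-refl = mk≈ λ _ _ → refl

  ≈-trans : ∀ {s t u} → s ≈ t → t ≈ u → s ≈ u
  ≈-trans p q = mk≈ λ f m → trans (L-≡ p f m) (L-≡ q f m)

  β-cong : ∀ {s s′ t t′} → s ≈ s′ → t ≈ t′ → β s t ≡ β s′ t′
  β-cong {s} {s′} p q = trans (L-cong s (L-≡ q catalan) 0) (L-≡ p _ 0)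

  node-cong : ∀ {l l′ r r′} → l ≈ l′ → r ≈ r′ → node l r ≈ node l′ r′
  node-cong {l} p q = mk≈ λ f m → cong₂ (λ x y → x - y * f (suc m))
    (trans (L-cong l (L-≡ q f) m) (L-≡ p _ m)) (β-cong p q)

  node-comm : ∀ l r → node l r ≈ node r l
  node-comm l r = mk≈ λ f m → cong₂ (λ x y → x - y * f (suc m)) (L-comm l r f m) (β-comm l r)

  -- Both sides are β s t shifted by one, minus β leaf s * β leaf t.
  β-slide : ∀ s t → β (node leaf s) t ≡ β s (node leaf t)
  β-slide s t = begin
    L s (L t catalan) 1 - β leaf s * L t catalan 1
      ≡⟨ cong₂ _-_ (sym (L-shift s (L t catalan) 0)) (swap (β leaf s) (L t catalan 1)) ⟩
    L s (L t catalan ∘ suc) 0 - L t catalan 1 * L s catalan 1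
      ≡⟨ cong (λ x → L s (L t catalan ∘ suc) 0 - L t catalan 1 * x) (L-shift s catalan 0) ⟨
    L s (L t catalan ∘ suc) 0 - L t catalan 1 * L s (catalan ∘ suc) 0
      ≡⟨ L-linear s (L t catalan ∘ suc) (catalan ∘ suc) (L t catalan 1) 0 ⟨
    L s (L (node leaf t) catalan) 0 ∎
    where
    open ≡-Reasoning
    swap : ∀ a b → a * b ≡ b * a
    swap = ℤ-Solver.solve-∀

  -- The normal form of a run of `k` non-branching nodes above `t`: every leaf child is on the left.
  wrap : ℕ → Tree → Tree
  wrap zero    t = t
  wrap (suc k) t = node leaf (wrap k t)

  -- Chain nodes slide across the root one at a time, so only their total number counts.
  β-wrap : ∀ k k′ s t → β (wrap k s) (wrap k′ t) ≡ β s (wrap (k ℕ.+ k′) t)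
  β-wrap zero    k′ s t = refl
  β-wrap (suc k) k′ s t = trans (β-slide (wrap k s) (wrap k′ t))
    (trans (β-wrap k (suc k′) s t) (cong (λ j → β s (wrap j t)) (ℕₚ.+-suc k k′)))

  numAvoidersℤ : Forest → Seq
  numAvoidersℤ ts m = + numAvoiders (replicate m leaf ++ ts)

  replicate-++-∷ : ∀ {A : Set} m (x : A) xs → replicate m x ++ x ∷ xs ≡ x ∷ replicate m x ++ xs
  replicate-++-∷ zero    x xs = refl
  replicate-++-∷ (suc m) x xs = cong (x ∷_) (replicate-++-∷ m x xs)

  -- The bridge from counts to operators. For a node it is the recurrence solved for #(node l r),
  -- whose coefficient #(l r) is an operator value by the same statement for the smaller trees `l`
  -- and `r`.
  numAvoiders-L : ∀ t ts m → numAvoidersℤ (t ∷ ts) m ≡ L t (numAvoidersℤ ts) m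

  numAvoiders-L₂ : ∀ l r ts m → numAvoidersℤ (l ∷ r ∷ ts) m ≡ L l (L r (numAvoidersℤ ts)) m
  numAvoiders-L₂ l r ts m = trans (numAvoiders-L l (r ∷ ts) m) (L-cong l (numAvoiders-L r ts) m)

  numAvoiders-β : ∀ l r → + numAvoiders (l ∷ r ∷ []) ≡ β l r
  numAvoiders-β l r = trans (numAvoiders-L₂ l r [] 0)
    (L-cong l (L-cong r (λ k → cong (+_ ∘ numAvoiders) (++-identityʳ (replicate k leaf)))) 0)

  numAvoiders-L leaf ts m = cong (+_ ∘ numAvoiders) (replicate-++-∷ m leaf ts)
  numAvoiders-L (node l r) ts m = begin
    a                                              ≡⟨ cancel a b (+ q) ⟩
    (a + b * + q) - + q * b                        ≡⟨ cong (_- + q * b) split ⟨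
    numAvoidersℤ (l ∷ r ∷ ts) m - + q * b          ≡⟨ cong₂ _-_ (numAvoiders-L₂ l r ts m)
                                                        (cong₂ _*_ (numAvoiders-β l r) (cong (+_ ∘ numAvoiders) (replicate-++-∷ m leaf ts))) ⟩
    L l (L r (numAvoidersℤ ts)) m - L l (L r catalan) 0 * numAvoidersℤ ts (suc m) ∎
    where
    open ≡-Reasoning
    a = numAvoidersℤ (node l r ∷ ts) m
    b = numAvoidersℤ (leaf ∷ ts) m
    q = numAvoiders (l ∷ r ∷ [])
    cancel : ∀ a b q → a ≡ (a + b * q) - q * b
    cancel = ℤ-Solver.solve-∀
    split : numAvoidersℤ (l ∷ r ∷ ts) m ≡ a + b * + q
    split = trans (cong +_ (numAvoiders-split (replicate m leaf) l r ts))
      (trans (pos-+ (numAvoiders (replicate m leaf ++ node l r ∷ ts)) _)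
             (cong (_+_ a) (pos-* (numAvoiders (replicate m leaf ++ leaf ∷ ts)) q)))

-- Normal forms of trees and their reconstruction from the internal triangles.

module Cores where

  open Forests
  open Operators
  open import Data.Nat.Base
  open import Data.Nat.Properties
  open import Data.Integer.Base using (ℤ; +_)
  open import Data.Integer.Properties using (+-injective)
  open import Data.List.Base using ([]; _∷_)
  open import Data.Product.Base using (_×_; _,_)
  open import Data.Sum.Base using (_⊎_; inj₁; inj₂)
  open import Data.Empty using (⊥-elim)
  open import Relation.Binary.PropositionalEquality hiding ([_])

  private
    variable
      o x k y a b c lo hi : ℕ
      l r t : Tree

  -- With the vertices numbered from `o`, each leaf is a unit interval, and a non-leaf node is the
  -- segment from the first to the last vertex of its leaves. `root` carries equations so that it
  -- can be matched at arbitrary end points.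
  data Edge : ℕ → Tree → ℕ → ℕ → Set where
    root  : x ≡ o → y ≡ o + (leaves l + leaves r) → Edge o (node l r) x y
    left  : Edge o l x y → Edge o (node l r) x y
    right : Edge (o + leaves l) r x y → Edge o (node l r) x y

  Edge-≥ : ∀ t → Edge o t x y → o ≤ x
  Edge-≥ (node l r) (root refl _) = ≤-refl
  Edge-≥ (node l r) (left e)      = Edge-≥ l e
  Edge-≥ (node l r) (right e)     = ≤-trans (m≤m+n _ (leaves l)) (Edge-≥ r e)

  Edge-≤ : ∀ t → Edge o t x y → y ≤ o + leaves t
  Edge-≤ (node l r) (root _ refl) = ≤-refl
  Edge-≤ {o} (node l r) (left e)  = ≤-trans (Edge-≤ l e) (+-monoʳ-≤ o (m≤m+n (leaves l) (leaves r)))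
  Edge-≤ {o} (node l r) (right e) = ≤-trans (Edge-≤ r e) (≤-reflexive (+-assoc o (leaves l) (leaves r)))

  Edge-long : ∀ t → Edge o t x y → suc x < y
  Edge-long {o} (node l r) (root refl refl) =
    subst (_≤ o + (leaves l + leaves r)) (+-comm o 2) (+-monoʳ-≤ o (+-mono-≤ (leaves≥1 l) (leaves≥1 r)))
  Edge-long (node l r) (left e)  = Edge-long l e
  Edge-long (node l r) (right e) = Edge-long r e

  Edge-< : ∀ t → Edge o t x y → x < y
  Edge-< t e = <-trans (n<1+n _) (Edge-long t e)

  -- A core records the branching nodes of a tree, those with two non-leaf
  -- children, as triples of vertices; the nodes with a leaf child are forgotten.
  data Core : Set where
    none : Core
    br   : (a c b : ℕ) → Core → Core → Core

  data ⟨_,_,_⟩∈_ : ℕ → ℕ → ℕ → Core → Set where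
    top : ∀ {K K′} → ⟨ a , c , b ⟩∈ br a c b K K′
    inˡ : ∀ {K K′} → ⟨ x , k , y ⟩∈ K → ⟨ x , k , y ⟩∈ br a c b K K′
    inʳ : ∀ {K K′} → ⟨ x , k , y ⟩∈ K′ → ⟨ x , k , y ⟩∈ br a c b K K′

  core : ℕ → Tree → Core
  core o leaf                             = none
  core o (node leaf r)                    = core (o + 1) r
  core o (node l@(node _ _) leaf)         = core o l
  core o (node l@(node _ _) r@(node _ _)) =
    br o (o + leaves l) (o + (leaves l + leaves r)) (core o l) (core (o + leaves l) r)

  Triangle : (ℕ → ℕ → Set) → ℕ → ℕ → ℕ → Set
  Triangle R x k y = R x k × R k y × R x y

  Triangle-left : ∀ r → Triangle (Edge o l) x k y → Triangle (Edge o (node l r)) x k y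
  Triangle-left r (e₁ , e₂ , e₃) = left e₁ , left e₂ , left e₃

  Triangle-right : ∀ l → Triangle (Edge (o + leaves l) r) x k y → Triangle (Edge o (node l r)) x k y
  Triangle-right l (e₁ , e₂ , e₃) = right e₁ , right e₂ , right e₃

  ∈-core⇒Triangle : ∀ o t → ⟨ x , k , y ⟩∈ core o t → Triangle (Edge o t) x k y
  ∈-core⇒Triangle o (node leaf r) i = Triangle-right leaf (∈-core⇒Triangle (o + 1) r i)
  ∈-core⇒Triangle o (node l@(node _ _) leaf) i = Triangle-left leaf (∈-core⇒Triangle o l i)
  ∈-core⇒Triangle o (node l@(node _ _) r@(node _ _)) top =
    left (root refl refl) , right (root refl (sym (+-assoc o (leaves l) (leaves r)))) , root refl refl
  ∈-core⇒Triangle o (node l@(node _ _) r@(node _ _)) (inˡ i) = Triangle-left r (∈-core⇒Triangle o l i)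
  ∈-core⇒Triangle o (node l@(node _ _) r@(node _ _)) (inʳ i) = Triangle-right l (∈-core⇒Triangle (o + leaves l) r i)

  data Split (o : ℕ) (l r : Tree) (x k y : ℕ) : Set where
    atRoot  : Edge o l o k → Edge (o + leaves l) r k y → x ≡ o → k ≡ o + leaves l →
              y ≡ o + (leaves l + leaves r) → Split o l r x k y
    inLeft  : Triangle (Edge o l) x k y → Split o l r x k y
    inRight : Triangle (Edge (o + leaves l) r) x k y → Split o l r x k y

  -- The two short edges share the vertex `k`. If they lie in different children, then `k` is where
  -- the children meet and only the root is left for the long edge. If they lie in the same child,
  -- the root is too long.
  split : ∀ o l r → Triangle (Edge o (node l r)) x k y → Split o l r x k y
  split o l r (e₁ , e₂ , e₃) = go (Edge-< (node l r) e₁) (Edge-< (node l r) e₂) e₁ e₂ e₃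
    where
    mid : ∀ {x y} → Edge o l x y → y ≤ o + leaves l
    mid = Edge-≤ l
    mid′ : ∀ {x y} → Edge (o + leaves l) r x y → o + leaves l ≤ x
    mid′ = Edge-≥ r
    o<mid : o < o + leaves l
    o<mid = m<m+n o (leaves≥1 l)
    go : x < k → k < y → Edge o (node l r) x k → Edge o (node l r) k y → Edge o (node l r) x y → Split o l r x k y
    go x<k k<y (root _ refl) e₂ _ = ⊥-elim (<⇒≱ k<y (Edge-≤ (node l r) e₂))
    go x<k k<y e₁ (root refl _) _ = ⊥-elim (<⇒≱ x<k (Edge-≥ (node l r) e₁))
    go x<k k<y (left e₁)  (left e₂)  (left e₃)  = inLeft (e₁ , e₂ , e₃)
    go x<k k<y (right e₁) (right e₂) (right e₃) = inRight (e₁ , e₂ , e₃)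
    go x<k k<y (left e₁)  (right e₂) (root refl y≡) =
      atRoot e₁ e₂ refl (≤-antisym (mid e₁) (mid′ e₂)) y≡
    go x<k k<y (left e₁)  (left e₂)  (root _ refl) =
      ⊥-elim (<⇒≱ (+-monoʳ-< o (m<m+n (leaves l) (leaves≥1 r))) (mid e₂))
    go x<k k<y (right e₁) _          (root refl _) = ⊥-elim (<⇒≱ o<mid (mid′ e₁))
    go x<k k<y (right e₁) _          (left e₃)  = ⊥-elim (<⇒≱ (<-≤-trans (<-trans x<k k<y) (mid e₃)) (mid′ e₁))
    go x<k k<y (left e₁)  _          (right e₃) = ⊥-elim (<⇒≱ (<-≤-trans x<k (mid e₁)) (mid′ e₃))
    go x<k k<y (left e₁)  (right e₂) (left e₃)  = ⊥-elim (<⇒≱ (<-≤-trans k<y (mid e₃)) (mid′ e₂))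
    go x<k k<y (right e₁) (left e₂)  (right e₃) = ⊥-elim (<⇒≱ (<-≤-trans k<y (mid e₂)) (<⇒≤ (≤-<-trans (mid′ e₁) x<k)))

  Triangle⇒∈-core : ∀ o t → Triangle (Edge o t) x k y → ⟨ x , k , y ⟩∈ core o t
  Triangle⇒∈-core o leaf (() , _)
  Triangle⇒∈-core o (node l r) tr with split o l r tr
  Triangle⇒∈-core o (node leaf r) tr | inRight e = Triangle⇒∈-core (o + 1) r e
  Triangle⇒∈-core o (node l@(node _ _) leaf) tr | inLeft e = Triangle⇒∈-core o l e
  Triangle⇒∈-core o (node l@(node _ _) r@(node _ _)) tr | atRoot _ _ refl refl refl = top
  Triangle⇒∈-core o (node l@(node _ _) r@(node _ _)) tr | inLeft e  = inˡ (Triangle⇒∈-core o l e)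
  Triangle⇒∈-core o (node l@(node _ _) r@(node _ _)) tr | inRight e = inʳ (Triangle⇒∈-core _ r e)
  Triangle⇒∈-core o (node leaf r) tr | inLeft (() , _)
  Triangle⇒∈-core o (node leaf r) tr | atRoot () _ _ _ _
  Triangle⇒∈-core o (node (node _ _) leaf) tr | inRight (() , _)
  Triangle⇒∈-core o (node (node _ _) leaf) tr | atRoot _ () _ _ _

  -- The bounds express that the triangles are nested, without which a core could not be recovered
  -- from its set of triples.
  data Within : ℕ → ℕ → Core → Set where
    none : Within lo hi none
    br   : ∀ {K K′} → lo ≤ a → b ≤ hi → a < c → c < b → Within a c K → Within c b K′ →
           Within lo hi (br a c b K K′)

  Within-weaken : ∀ {lo lo′ hi hi′ K} → lo′ ≤ lo → hi ≤ hi′ → Within lo hi K → Within lo′ hi′ K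
  Within-weaken p q none = none
  Within-weaken p q (br a b c d e f) = br (≤-trans p a) (≤-trans b q) c d e f

  core-within : ∀ o t → Within o (o + leaves t) (core o t)
  core-within o leaf = none
  core-within o (node leaf r) =
    Within-weaken (m≤m+n o 1) (≤-reflexive (+-assoc o 1 (leaves r))) (core-within (o + 1) r)
  core-within o (node l@(node _ _) leaf) =
    Within-weaken ≤-refl (+-monoʳ-≤ o (m≤m+n (leaves l) 1)) (core-within o l)
  core-within o (node l@(node _ _) r@(node _ _)) =
    br ≤-refl ≤-refl (m<m+n o (leaves≥1 l)) (+-monoʳ-< o (m<m+n (leaves l) (leaves≥1 r)))
      (core-within o l)
      (Within-weaken ≤-refl (≤-reflexive (+-assoc o (leaves l) (leaves r))) (core-within (o + leaves l) r))

  record Bounds (lo hi x k y : ℕ) : Set where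
    constructor bounds
    field
      lo≤x : lo ≤ x
      x<k  : x < k
      k<y  : k < y
      y≤hi : y ≤ hi

    x<y : x < y
    x<y = <-trans x<k k<y
  open Bounds

  ∈-bounds : ∀ {K} → Within lo hi K → ⟨ x , k , y ⟩∈ K → Bounds lo hi x k y
  ∈-bounds (br p q r s _ _)   top     = bounds p r s q
  ∈-bounds (br p q r s w₁ w₂) (inˡ i) with bounds p′ r′ s′ q′ ← ∈-bounds w₁ i =
    bounds (≤-trans p p′) r′ s′ (≤-trans q′ (≤-trans (<⇒≤ s) q))
  ∈-bounds (br p q r s w₁ w₂) (inʳ i) with bounds p′ r′ s′ q′ ← ∈-bounds w₂ i =
    bounds (≤-trans p (≤-trans (<⇒≤ r) p′)) r′ s′ (≤-trans q′ q)

  ∈-bounds-top : ∀ {K K′} → Within lo hi (br a c b K K′) → ⟨ x , k , y ⟩∈ br a c b K K′ → Bounds a b x k y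
  ∈-bounds-top (br p q r s w₁ w₂) = ∈-bounds (br ≤-refl ≤-refl r s w₁ w₂)

  infix 4 _⊑_
  _⊑_ : Core → Core → Set
  K ⊑ K′ = ∀ {x k y} → ⟨ x , k , y ⟩∈ K → ⟨ x , k , y ⟩∈ K′

  ⊑none : ∀ {K} → K ⊑ none → K ≡ none
  ⊑none {none} _ = refl
  ⊑none {br _ _ _ _ _} s with () ← s top

  -- The top triple spans all the others, so equal sets of triples have equal tops. The vertex `c`
  -- then sorts the remaining triples into the two sides.
  core-ext : ∀ {lo hi lo′ hi′ K K′} → Within lo hi K → Within lo′ hi′ K′ → K ⊑ K′ → K′ ⊑ K → K ≡ K′
  core-ext none w′ s s′ = sym (⊑none s′)
  core-ext w@(br _ _ _ _ _ _) none s s′ = ⊑none s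
  core-ext {K = K} {K′} w@(br {a = a} {b = b} {c = c} {K = A} {K′ = B} _ _ a<c c<b wA wB)
    w′@(br {a = a′} {b = b′} {c = c′} {K = A′} {K′ = B′} _ _ a′<c′ c′<b′ wA′ wB′) s s′
    with refl ← ≤-antisym (lo≤x (∈-bounds-top w (s′ top))) (lo≤x (∈-bounds-top w′ (s top)))
       | refl ← ≤-antisym (y≤hi (∈-bounds-top w′ (s top))) (y≤hi (∈-bounds-top w (s′ top)))
    with s top
  ... | inˡ i = ⊥-elim (<⇒≱ c′<b′ (y≤hi (∈-bounds wA′ i)))
  ... | inʳ i = ⊥-elim (<⇒≱ a′<c′ (lo≤x (∈-bounds wB′ i)))
  ... | top = cong₂ (br a c b) (core-ext wA wA′ (lft wA w′ s) (lft wA′ w s′)) (core-ext wB wB′ (rgt wB w′ s) (rgt wB′ w s′))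
    where
    lft : ∀ {A A′ B B′} → Within a c A → Within lo hi (br a c b A′ B′) → br a c b A B ⊑ br a c b A′ B′ → A ⊑ A′
    lft wA (br _ _ _ c<b _ wB′) s i with s (inˡ i)
    ... | top = ⊥-elim (<⇒≱ c<b (y≤hi (∈-bounds wA i)))
    ... | inˡ j = j
    ... | inʳ j = ⊥-elim (<⇒≱ (<-≤-trans (x<y (∈-bounds wA i)) (y≤hi (∈-bounds wA i))) (lo≤x (∈-bounds wB′ j)))
    rgt : ∀ {A A′ B B′} → Within c b B → Within lo hi (br a c b A′ B′) → br a c b A B ⊑ br a c b A′ B′ → B ⊑ B′
    rgt wB (br _ _ a<c _ wA′ _) s i with s (inʳ i)
    ... | top = ⊥-elim (<⇒≱ a<c (lo≤x (∈-bounds wB i)))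
    ... | inˡ j = ⊥-elim (<⇒≱ (<-≤-trans (x<y (∈-bounds wA′ j)) (y≤hi (∈-bounds wA′ j))) (lo≤x (∈-bounds wB i)))
    ... | inʳ j = j

  fill : ℕ → Tree → Tree
  fill w t = wrap (w ∸ leaves t) t

  -- The smallest tree in normal form with the given branching nodes: a child that spans more leaves
  -- than its own core accounts for gets a chain of the missing length. No chain is put above the
  -- topmost branching node, since its length depends on the width of the whole tree.
  coreTree : Core → Tree
  coreTree none            = leaf
  coreTree (br a c b K K′) = node (fill (c ∸ a) (coreTree K)) (fill (b ∸ c) (coreTree K′))

  leaves-wrap : ∀ k t → leaves (wrap k t) ≡ k + leaves t
  leaves-wrap zero    t = refl
  leaves-wrap (suc k) t = cong suc (leaves-wrap k t)

  leaves-fill : ∀ w t → leaves t ≤ w → leaves (fill w t) ≡ w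
  leaves-fill w t p = trans (leaves-wrap (w ∸ leaves t) t) (m∸n+n≡m p)

  fill-suc : ∀ w t → leaves t ≤ w → fill (suc w) t ≡ node leaf (fill w t)
  fill-suc w t p = cong (λ k → wrap k t) (+-∸-assoc 1 p)

  coreTree-br : ∀ o l r (K K′ : Core) →
    coreTree (br o (o + leaves l) (o + (leaves l + leaves r)) K K′) ≡
    node (fill (leaves l) (coreTree K)) (fill (leaves r) (coreTree K′))
  coreTree-br o l r K K′ = cong₂ (λ v w → node (fill v (coreTree K)) (fill w (coreTree K′)))
    (m+n∸m≡n o (leaves l))
    (trans (cong (_∸ (o + leaves l)) (sym (+-assoc o (leaves l) (leaves r)))) (m+n∸m≡n (o + leaves l) (leaves r)))

  -- This makes the truncated subtraction in `fill` exact.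
  leaves-core : ∀ o t → leaves (coreTree (core o t)) ≤ leaves t

  leaves-core-br : ∀ o l r →
    leaves (node (fill (leaves l) (coreTree (core o l))) (fill (leaves r) (coreTree (core (o + leaves l) r))))
    ≡ leaves l + leaves r
  leaves-core-br o l r = cong₂ _+_
    (leaves-fill (leaves l) (coreTree (core o l)) (leaves-core o l))
    (leaves-fill (leaves r) (coreTree (core (o + leaves l) r)) (leaves-core (o + leaves l) r))

  leaves-core o leaf                     = ≤-refl
  leaves-core o (node leaf r)            = ≤-trans (leaves-core (o + 1) r) (n≤1+n _)
  leaves-core o (node l@(node _ _) leaf) = ≤-trans (leaves-core o l) (m≤m+n _ 1)
  leaves-core o (node l@(node _ _) r@(node _ _)) = ≤-reflexive (trans
    (cong leaves (coreTree-br o l r (core o l) (core (o + leaves l) r))) (leaves-core-br o l r))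

  -- A node with a leaf child lengthens the chain by one, after an exchange of children if the leaf
  -- is on the right. A branching node already has full width, so the outer `fill` adds nothing to
  -- it.
  ≈-core : ∀ o t → t ≈ fill (leaves t) (coreTree (core o t))
  ≈-core o leaf = ≈-refl
  ≈-core o (node leaf r) = subst (node leaf r ≈_)
    (sym (fill-suc (leaves r) (coreTree (core (o + 1) r)) (leaves-core (o + 1) r)))
    (node-cong ≈-refl (≈-core (o + 1) r))
  ≈-core o t@(node l@(node _ _) leaf) = subst (t ≈_)
    (trans (sym (fill-suc (leaves l) (coreTree (core o l)) (leaves-core o l)))
           (cong (λ w → fill w (coreTree (core o l))) (+-comm 1 (leaves l))))
    (≈-trans (node-comm l leaf) (node-cong ≈-refl (≈-core o l)))
  ≈-core o t@(node l@(node _ _) r@(node _ _)) = subst (t ≈_) (sym fill-core)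
    (node-cong (≈-core o l) (≈-core (o + leaves l) r))
    where
    s : Tree
    s = node (fill (leaves l) (coreTree (core o l))) (fill (leaves r) (coreTree (core (o + leaves l) r)))
    fill-core : fill (leaves t) (coreTree (core o t)) ≡ s
    fill-core = trans
      (cong (fill (leaves t)) (coreTree-br o l r (core o l) (core (o + leaves l) r)))
      (cong (λ k → wrap k s) (trans (cong (leaves t ∸_) (leaves-core-br o l r)) (n∸n≡0 (leaves t))))

  -- All chain nodes next to the root have been moved to its right. Only the total width `w` enters,
  -- not the vertex at which the root splits.
  rootValue : ℕ → Core → Core → ℤ
  rootValue w K K′ = β (coreTree K) (wrap (w ∸ (leaves (coreTree K) + leaves (coreTree K′))) (coreTree K′))

  β-core : ∀ o o′ l r → β l r ≡ rootValue (leaves l + leaves r) (core o l) (core o′ r)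
  β-core o o′ l r = trans (β-cong (≈-core o l) (≈-core o′ r))
    (trans (β-wrap (leaves l ∸ leaves (coreTree (core o l))) (leaves r ∸ leaves (coreTree (core o′ r)))
                   (coreTree (core o l)) (coreTree (core o′ r)))
           (cong (λ k → β (coreTree (core o l)) (wrap k (coreTree (core o′ r))))
                 (lemma (leaves-core o l) (leaves-core o′ r))))
    where
    lemma : ∀ {m n m′ n′} → m′ ≤ m → n′ ≤ n → (m ∸ m′) + (n ∸ n′) ≡ (m + n) ∸ (m′ + n′)
    lemma {m} {n} {m′} {n′} p q = begin
      (m ∸ m′) + (n ∸ n′)  ≡⟨ +-∸-assoc (m ∸ m′) q ⟨
      (m ∸ m′) + n ∸ n′    ≡⟨ cong (_∸ n′) (+-∸-comm n p) ⟨
      m + n ∸ m′ ∸ n′      ≡⟨ ∸-+-assoc (m + n) m′ n′ ⟩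
      (m + n) ∸ (m′ + n′)  ∎
      where open ≡-Reasoning

  -- Commutativity of `β` carries the core to the other side of the root, and the chain then slides
  -- back over it.
  rootValue-none : ∀ w K → rootValue w K none ≡ rootValue w none K
  rootValue-none w K = begin
    β s (wrap p leaf)          ≡⟨ β-comm s (wrap p leaf) ⟩
    β (wrap p leaf) s          ≡⟨ β-wrap p 0 leaf s ⟩
    β leaf (wrap (p + 0) s)    ≡⟨ cong (λ k → β leaf (wrap k s)) (trans (+-identityʳ p) (cong (w ∸_) (+-comm (leaves s) 1))) ⟩
    rootValue w none K         ∎
    where
    open ≡-Reasoning
    s = coreTree K
    p = w ∸ (leaves s + 1)

  ⟨_,_,_⟩∈[_,_] : ℕ → ℕ → ℕ → Core → Core → Set
  ⟨ x , k , y ⟩∈[ K , K′ ] = ⟨ x , k , y ⟩∈ K ⊎ ⟨ x , k , y ⟩∈ K′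

  -- The split vertices `p` and `p′` are not visible in the triples. As p ≤ p′, a triple can only
  -- pass from `K₂` to `K₁′`. Since each core has a single top that spans it, either no triple
  -- passes or all of `K₂` does, with nothing else on the other sides.
  rootValue-≤ : ∀ {w p p′ K₁ K₂ K₁′ K₂′} → p ≤ p′ →
    Within 0 p K₁ → Within p w K₂ → Within 0 p′ K₁′ → Within p′ w K₂′ →
    (∀ {x k y} → ⟨ x , k , y ⟩∈[ K₁ , K₂ ] → ⟨ x , k , y ⟩∈[ K₁′ , K₂′ ]) →
    (∀ {x k y} → ⟨ x , k , y ⟩∈[ K₁′ , K₂′ ] → ⟨ x , k , y ⟩∈[ K₁ , K₂ ]) →
    rootValue w K₁ K₂ ≡ rootValue w K₁′ K₂′
  rootValue-≤ {w} {p} {p′} {K₁} {K₂} {K₁′} {K₂′} p≤p′ W₁ W₂ W₁′ W₂′ f f′ = go W₁′ W₂ refl refl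
    where
    apart : ∀ {q x y} {A : Set} → x < y → y ≤ q → q ≤ x → A
    apart x<y y≤q q≤x = ⊥-elim (<⇒≱ (<-≤-trans x<y y≤q) q≤x)
    1⊑ : K₁ ⊑ K₁′
    1⊑ i with f (inj₁ i)
    ... | inj₁ j = j
    ... | inj₂ j = let B = ∈-bounds W₁ i in apart (x<y B) (y≤hi B) (≤-trans p≤p′ (lo≤x (∈-bounds W₂′ j)))
    2⊒ : K₂′ ⊑ K₂
    2⊒ i with f′ (inj₂ i)
    ... | inj₁ j = let B = ∈-bounds W₁ j in apart (x<y B) (y≤hi B) (≤-trans p≤p′ (lo≤x (∈-bounds W₂′ i)))
    ... | inj₂ j = j
    aligned : K₁′ ⊑ K₁ → rootValue w K₁ K₂ ≡ rootValue w K₁′ K₂′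
    aligned 1⊒ = cong₂ (rootValue w) (core-ext W₁ W₁′ 1⊑ 1⊒) (core-ext W₂ W₂′ 2⊑ 2⊒)
      where
      2⊑ : K₂ ⊑ K₂′
      2⊑ i with f (inj₂ i)
      ... | inj₁ j = let B = ∈-bounds W₁ (1⊒ j) in apart (x<y B) (y≤hi B) (lo≤x (∈-bounds W₂ i))
      ... | inj₂ j = j
    go : ∀ {K K′} → Within 0 p′ K → Within p w K′ → K₁′ ≡ K → K₂ ≡ K′ → rootValue w K₁ K₂ ≡ rootValue w K₁′ K₂′
    go none _ refl _ = aligned λ ()
    go (br _ _ _ _ _ _) _ refl _ with f′ (inj₁ top)
    -- The top of `K₁′` ends by `p`, hence so does everything below it, and nothing has passed.
    ... | inj₁ i = aligned 1⊒
      where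
      1⊒ : K₁′ ⊑ K₁
      1⊒ j with f′ (inj₁ j)
      ... | inj₁ h = h
      ... | inj₂ h = let B = ∈-bounds-top W₁′ j in
        apart (x<y B) (≤-trans (y≤hi B) (y≤hi (∈-bounds W₁ i))) (lo≤x (∈-bounds W₂ h))
    go (br _ _ _ _ _ _) none refl refl | inj₂ ()
    go (br _ _ _ _ _ _) (br _ _ _ _ _ _) refl refl | inj₂ i with f (inj₂ top)
    -- A top of `K₂` beyond `p′` would put all of `K₂` there, including the top of `K₁′`, which ends
    -- by `p′`.
    ... | inj₂ j = let B = ∈-bounds W₁′ top in
      apart (x<y B) (y≤hi B) (≤-trans (lo≤x (∈-bounds W₂′ j)) (lo≤x (∈-bounds-top W₂ i)))
    -- Now `K₂` and `K₁′` are the same core on opposite sides of the root, facing empty cores.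
    ... | inj₁ j = trans (cong₂ (rootValue w) K₁≡none (core-ext W₂ W₁′ ⊑′ ⊒′))
                         (trans (sym (rootValue-none w K₁′)) (cong (rootValue w K₁′) (sym K₂′≡none)))
      where
      K₁≡none : K₁ ≡ none
      K₁≡none = ⊑none λ h → let B = ∈-bounds W₁ h in
        apart (x<y B) (y≤hi B) (≤-trans (lo≤x (∈-bounds W₂ i)) (lo≤x (∈-bounds-top W₁′ (1⊑ h))))
      K₂′≡none : K₂′ ≡ none
      K₂′≡none = ⊑none λ h → let B = ∈-bounds W₂′ h in
        apart (x<y B) (≤-trans (y≤hi (∈-bounds-top W₂ (2⊒ h))) (y≤hi (∈-bounds W₁′ j))) (lo≤x B)
      ⊑′ : K₂ ⊑ K₁′
      ⊑′ h with f (inj₂ h)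
      ... | inj₁ h′ = h′
      ... | inj₂ h′ with () ← subst (λ K → ⟨ _ , _ , _ ⟩∈ K) K₂′≡none h′
      ⊒′ : K₁′ ⊑ K₂
      ⊒′ h with f′ (inj₁ h)
      ... | inj₁ h′ with () ← subst (λ K → ⟨ _ , _ , _ ⟩∈ K) K₁≡none h′
      ⊒′ h | inj₂ h′ = h′

  rootValue-cong : ∀ {w p p′ K₁ K₂ K₁′ K₂′} →
    Within 0 p K₁ → Within p w K₂ → Within 0 p′ K₁′ → Within p′ w K₂′ →
    (∀ {x k y} → ⟨ x , k , y ⟩∈[ K₁ , K₂ ] → ⟨ x , k , y ⟩∈[ K₁′ , K₂′ ]) →
    (∀ {x k y} → ⟨ x , k , y ⟩∈[ K₁′ , K₂′ ] → ⟨ x , k , y ⟩∈[ K₁ , K₂ ]) →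
    rootValue w K₁ K₂ ≡ rootValue w K₁′ K₂′
  rootValue-cong {p = p} {p′} W₁ W₂ W₁′ W₂′ f f′ with ≤-total p p′
  ... | inj₁ p≤p′ = rootValue-≤ p≤p′ W₁ W₂ W₁′ W₂′ f f′
  ... | inj₂ p′≤p = sym (rootValue-≤ p′≤p W₁′ W₂′ W₁ W₂ f′ f)

  data ForestEdge : ℕ → Forest → ℕ → ℕ → Set where
    here  : ∀ {ts} → Edge o t x y → ForestEdge o (t ∷ ts) x y
    there : ∀ {ts} → ForestEdge (o + leaves t) ts x y → ForestEdge o (t ∷ ts) x y

  children : Tree → Forest
  children leaf       = []
  children (node l r) = l ∷ r ∷ []

  Chord : Tree → ℕ → ℕ → Set
  Chord t = ForestEdge 0 (children t)

  Chord⇒Edge : Chord t x y → Edge 0 t x y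
  Chord⇒Edge {node l r} (here e)         = left e
  Chord⇒Edge {node l r} (there (here e)) = right e

  Triangle⇒∈-cores : ∀ l r → Triangle (Chord (node l r)) x k y →
    ⟨ x , k , y ⟩∈[ core 0 l , core (leaves l) r ]
  Triangle⇒∈-cores l r (e₁ , e₂ , e₃) with split 0 l r (Chord⇒Edge e₁ , Chord⇒Edge e₂ , Chord⇒Edge e₃)
  ... | inLeft tr  = inj₁ (Triangle⇒∈-core 0 l tr)
  ... | inRight tr = inj₂ (Triangle⇒∈-core (leaves l) r tr)
  -- The long edge would be the root, which is a side of the polygon and not a chord.
  ... | atRoot _ _ refl _ refl with e₃
  ...   | here e         = ⊥-elim (<⇒≱ (m<m+n (leaves l) (leaves≥1 r)) (Edge-≤ l e))
  ...   | there (here e) = ⊥-elim (<⇒≱ (leaves≥1 l) (Edge-≥ r e))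

  ∈-cores⇒Triangle : ∀ l r → ⟨ x , k , y ⟩∈[ core 0 l , core (leaves l) r ] →
    Triangle (Chord (node l r)) x k y
  ∈-cores⇒Triangle l r (inj₁ i) =
    let e₁ , e₂ , e₃ = ∈-core⇒Triangle 0 l i in here e₁ , here e₂ , here e₃
  ∈-cores⇒Triangle l r (inj₂ i) =
    let e₁ , e₂ , e₃ = ∈-core⇒Triangle (leaves l) r i in there (here e₁) , there (here e₂) , there (here e₃)

  numAvoiders-triangles : ∀ t t′ → leaves t ≡ leaves t′ →
    (∀ {x k y} → Triangle (Chord t) x k y → Triangle (Chord t′) x k y) →
    (∀ {x k y} → Triangle (Chord t′) x k y → Triangle (Chord t) x k y) →
    numAvoiders (children t) ≡ numAvoiders (children t′)
  numAvoiders-triangles leaf leaf _ _ _ = refl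
  numAvoiders-triangles leaf (node l r) e _ _ = ⊥-elim (<-irrefl e (+-mono-≤ (leaves≥1 l) (leaves≥1 r)))
  numAvoiders-triangles (node l r) leaf e _ _ = ⊥-elim (<-irrefl (sym e) (+-mono-≤ (leaves≥1 l) (leaves≥1 r)))
  numAvoiders-triangles (node l r) (node l′ r′) e f f′ = +-injective (begin
    + numAvoiders (l ∷ r ∷ [])
      ≡⟨ numAvoiders-β l r ⟩
    β l r
      ≡⟨ β-core 0 (leaves l) l r ⟩
    rootValue (leaves l + leaves r) (core 0 l) (core (leaves l) r)
      ≡⟨ rootValue-cong (core-within 0 l) (core-within (leaves l) r) (core-within 0 l′)
           (subst (λ w → Within (leaves l′) w (core (leaves l′) r′)) (sym e) (core-within (leaves l′) r′))
           (λ i → Triangle⇒∈-cores l′ r′ (f (∈-cores⇒Triangle l r i)))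
           (λ i → Triangle⇒∈-cores l r (f′ (∈-cores⇒Triangle l′ r′ i))) ⟩
    rootValue (leaves l + leaves r) (core 0 l′) (core (leaves l′) r′)
      ≡⟨ cong (λ w → rootValue w (core 0 l′) (core (leaves l′) r′)) e ⟩
    rootValue (leaves l′ + leaves r′) (core 0 l′) (core (leaves l′) r′)
      ≡⟨ β-core 0 (leaves l′) l′ r′ ⟨
    β l′ r′
      ≡⟨ numAvoiders-β l′ r′ ⟨
    + numAvoiders (l′ ∷ r′ ∷ []) ∎)
    where open ≡-Reasoning

-- The list of avoiders is sound, complete and free of repetitions.

module Avoiders where

  open Forests
  open Cores
  open import Data.Nat.Base
  open import Data.Nat.Properties
  open import Data.List.Base using (List; []; _∷_; [_]; _++_; map; cartesianProductWith; applyUpTo)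
  open import Data.List.Properties using (map-++; map-∘; ++-assoc; map-applyUpTo)
  open import Data.List.Relation.Unary.All as All using (All; []; _∷_)
  import Data.List.Relation.Unary.All.Properties as Allₚ
  open import Data.List.Relation.Unary.Any using (here; there)
  open import Data.List.Relation.Unary.AllPairs as AllPairs using (AllPairs; []; _∷_)
  import Data.List.Relation.Unary.AllPairs.Properties as AllPairsₚ
  open import Data.List.Relation.Unary.Unique.Propositional using (Unique)
  import Data.List.Relation.Unary.Unique.Propositional.Properties as Uniqueₚ
  open import Data.List.Membership.Propositional using (_∈_; find; lose)
  open import Data.List.Membership.Propositional.Properties using (∈-map⁻; ∈-concatMap⁺; ∈-concatMap⁻; ∈-cartesianProductWith⁺; ∈-cartesianProductWith⁻; ∈-applyUpTo⁺)
  open import Data.List.Relation.Binary.Disjoint.Propositional using (Disjoint)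
  open import Data.Product.Base using (_×_; _,_; proj₁; proj₂; ∃)
  open import Data.Sum.Base using (_⊎_; inj₁; inj₂)
  open import Data.Empty using (⊥-elim)
  open import Function.Base using (_∘_)
  open import Relation.Nullary.Negation.Core using (¬_)
  open import Relation.Binary.PropositionalEquality hiding ([_])

  private
    variable
      o x y : ℕ

  ForestEdge-≥ : ∀ ts → ForestEdge o ts x y → o ≤ x
  ForestEdge-≥ (t ∷ ts) (here e)  = Edge-≥ t e
  ForestEdge-≥ (t ∷ ts) (there e) = ≤-trans (m≤m+n _ (leaves t)) (ForestEdge-≥ ts e)

  ForestEdge-≤ : ∀ ts → ForestEdge o ts x y → y ≤ o + width ts
  ForestEdge-≤ {o} (t ∷ ts) (here e)  = ≤-trans (Edge-≤ t e) (+-monoʳ-≤ o (m≤m+n (leaves t) (width ts)))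
  ForestEdge-≤ {o} (t ∷ ts) (there e) = ≤-trans (ForestEdge-≤ ts e) (≤-reflexive (+-assoc o (leaves t) (width ts)))

  ForestEdge-< : ∀ ts → ForestEdge o ts x y → x < y
  ForestEdge-< (t ∷ ts) (here e)  = Edge-< t e
  ForestEdge-< (t ∷ ts) (there e) = ForestEdge-< ts e

  ++ˡ : ∀ us vs → ForestEdge o us x y → ForestEdge o (us ++ vs) x y
  ++ˡ (u ∷ us) vs (here e)  = here e
  ++ˡ (u ∷ us) vs (there e) = there (++ˡ us vs e)

  ++ʳ : ∀ us vs → ForestEdge (o + width us) vs x y → ForestEdge o (us ++ vs) x y
  ++ʳ {o} {x} {y} []       vs e = subst (λ z → ForestEdge z vs x y) (+-identityʳ o) e
  ++ʳ {o} {x} {y} (u ∷ us) vs e =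
    there (++ʳ us vs (subst (λ z → ForestEdge z vs x y) (sym (+-assoc o (leaves u) (width us))) e))

  ++⁻ : ∀ us vs → ForestEdge o (us ++ vs) x y → ForestEdge o us x y ⊎ ForestEdge (o + width us) vs x y
  ++⁻ {o} {x} {y} []       vs e = inj₂ (subst (λ z → ForestEdge z vs x y) (sym (+-identityʳ o)) e)
  ++⁻ {o} {x} {y} (u ∷ us) vs (here e)  = inj₁ (here e)
  ++⁻ {o} {x} {y} (u ∷ us) vs (there e) with ++⁻ us vs e
  ... | inj₁ e′ = inj₁ (there e′)
  ... | inj₂ e′ = inj₂ (subst (λ z → ForestEdge z vs x y) (+-assoc o (leaves u) (width us)) e′)

  -- The geometric meaning of a cut: the edges that pass over the cut vertex are lost, and all
  -- others survive in the part on their side.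
  record CutEdges (o : ℕ) (ts : Forest) (c : Cut) : Set where
    constructor cutEdges
    us = proj₁ c
    vs = proj₂ c
    field
      toˡ : ∀ {x y} → ForestEdge o ts x y → y ≤ o + width us → ForestEdge o us x y
      toʳ : ∀ {x y} → ForestEdge o ts x y → o + width us ≤ x → ForestEdge (o + width us) vs x y
      fromˡ : ∀ {x y} → ForestEdge o us x y → ForestEdge o ts x y
      fromʳ : ∀ {x y} → ForestEdge (o + width us) vs x y → ForestEdge o ts x y
  open CutEdges using (toˡ; toʳ; fromˡ; fromʳ)

  ++-cutEdges : ∀ o us vs → CutEdges o (us ++ vs) (us , vs)
  ++-cutEdges o us vs = cutEdges l r (++ˡ us vs) (++ʳ us vs)
    where
    l : ForestEdge o (us ++ vs) x y → y ≤ o + width us → ForestEdge o us x y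
    l e y≤ with ++⁻ us vs e
    ... | inj₁ e′ = e′
    ... | inj₂ e′ = ⊥-elim (<⇒≱ (<-≤-trans (ForestEdge-< vs e′) y≤) (ForestEdge-≥ vs e′))
    r : ForestEdge o (us ++ vs) x y → o + width us ≤ x → ForestEdge (o + width us) vs x y
    r e ≤x with ++⁻ us vs e
    ... | inj₁ e′ = ⊥-elim (<⇒≱ (<-≤-trans (ForestEdge-< us e′) (ForestEdge-≤ us e′)) ≤x)
    ... | inj₂ e′ = e′

  ▸-cutEdges : ∀ {o ts} c zs → IsCut (width ts) c → CutEdges o ts c → CutEdges o (ts ++ zs) (c ▸ zs)
  ▸-cutEdges {o} {ts} (us , vs) zs (_ , w≡) C = cutEdges l r fl fr
    where
    offset : o + width us + width vs ≡ o + width ts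
    offset = trans (+-assoc o (width us) (width vs)) (cong (o +_) w≡)
    move : ∀ {x y} → ForestEdge (o + width ts) zs x y → ForestEdge (o + width us + width vs) zs x y
    move {x} {y} = subst (λ z → ForestEdge z zs x y) (sym offset)
    us≤ts : o + width us ≤ o + width ts
    us≤ts = subst (o + width us ≤_) offset (m≤m+n _ (width vs))
    l : ForestEdge o (ts ++ zs) x y → y ≤ o + width us → ForestEdge o us x y
    l e y≤ = toˡ C (toˡ (++-cutEdges o ts zs) e (≤-trans y≤ us≤ts)) y≤
    r : ForestEdge o (ts ++ zs) x y → o + width us ≤ x → ForestEdge (o + width us) (vs ++ zs) x y
    r e ≤x with ++⁻ ts zs e
    ... | inj₁ e′ = ++ˡ vs zs (toʳ C e′ ≤x)
    ... | inj₂ e′ = ++ʳ vs zs (move e′)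
    fl : ForestEdge o us x y → ForestEdge o (ts ++ zs) x y
    fl e = ++ˡ ts zs (fromˡ C e)
    fr : ForestEdge (o + width us) (vs ++ zs) x y → ForestEdge o (ts ++ zs) x y
    fr {x} {y} e with ++⁻ vs zs e
    ... | inj₁ e′ = ++ˡ ts zs (fromʳ C e′)
    ... | inj₂ e′ = ++ʳ ts zs (subst (λ z → ForestEdge z zs x y) offset e′)

  ◂-cutEdges : ∀ {o ts} t c → CutEdges (o + leaves t) ts c → CutEdges o (t ∷ ts) ([ t ] ◂ c)
  ◂-cutEdges {o} {ts} t (us , vs) C = cutEdges l r fl fr
    where
    offset : o + leaves t + width us ≡ o + (leaves t + width us)
    offset = +-assoc o (leaves t) (width us)
    l : ForestEdge o (t ∷ ts) x y → y ≤ o + (leaves t + width us) → ForestEdge o (t ∷ us) x y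
    l (here e)  y≤ = here e
    l {y = y} (there e) y≤ = there (toˡ C e (subst (y ≤_) (sym offset) y≤))
    r : ForestEdge o (t ∷ ts) x y → o + (leaves t + width us) ≤ x → ForestEdge (o + (leaves t + width us)) vs x y
    r {x} {y} (there e) ≤x = subst (λ z → ForestEdge z vs x y) offset (toʳ C e (subst (_≤ x) (sym offset) ≤x))
    r (here e)  ≤x = ⊥-elim (<⇒≱ (<-≤-trans (Edge-< t e) (Edge-≤ t e))
      (≤-trans (+-monoʳ-≤ o (m≤m+n (leaves t) (width us))) ≤x))
    fl : ForestEdge o (t ∷ us) x y → ForestEdge o (t ∷ ts) x y
    fl (here e)  = here e
    fl (there e) = there (fromˡ C e)
    fr : ForestEdge (o + (leaves t + width us)) vs x y → ForestEdge o (t ∷ ts) x y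
    fr {x} {y} e = there (fromʳ C (subst (λ z → ForestEdge z vs x y) (sym offset) e))

  -- With leaves on both sides of the cut, the root passes over the cut vertex and belongs to
  -- neither part, so joining `l` and `r` changes nothing.
  node-cutEdges : ∀ {o l r} c → IsInnerCut (leaves l + leaves r) c →
    CutEdges o (l ∷ r ∷ []) c → CutEdges o [ node l r ] c
  node-cutEdges {o} {l} {r} (us , vs) (1≤vs , 1≤us , w≡) C = cutEdges ll rr (up ∘ fromˡ C) (up ∘ fromʳ C)
    where
    up : ForestEdge o (l ∷ r ∷ []) x y → ForestEdge o [ node l r ] x y
    up (here e)         = here (left e)
    up (there (here e)) = here (right e)
    ll : ForestEdge o [ node l r ] x y → y ≤ o + width us → ForestEdge o us x y
    ll (here (left e))      y≤ = toˡ C (here e) y≤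
    ll (here (right e))     y≤ = toˡ C (there (here e)) y≤
    ll (here (root _ refl)) y≤ = ⊥-elim (<⇒≱ (subst (width us <_) w≡ (m<m+n (width us) 1≤vs)) (+-cancelˡ-≤ o _ _ y≤))
    rr : ForestEdge o [ node l r ] x y → o + width us ≤ x → ForestEdge (o + width us) vs x y
    rr (here (left e))      ≤x = toʳ C (here e) ≤x
    rr (here (right e))     ≤x = toʳ C (there (here e)) ≤x
    rr (here (root refl _)) ≤x = ⊥-elim (<⇒≱ (m<m+n o 1≤us) ≤x)

  innerCuts-edges : ∀ o t → All (CutEdges o [ t ]) (innerCuts t)
  innerCuts-edges o leaf       = []
  innerCuts-edges o (node l r) = All.zipWith (λ {c} (ic , C) → node-cutEdges c ic C)
    (innerCuts-isCut (node l r) , Allₚ.++⁺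
      (Allₚ.map⁺ (All.zipWith (λ {c} ((_ , ic) , C) → ▸-cutEdges c [ r ] (subst (λ w → IsCut w c) (sym (singleton-width l)) ic) C)
        (innerCuts-isCut l , innerCuts-edges o l)))
      (++-cutEdges o [ l ] [ r ] ∷
       Allₚ.map⁺ (All.map (λ {c} → ◂-cutEdges l c) (innerCuts-edges (o + leaves l) r))))

  cuts-edges : ∀ o ts → All (CutEdges o ts) (cuts ts)
  cuts-edges o []       = []
  cuts-edges o (t ∷ ts) = Allₚ.++⁺
    (Allₚ.map⁺ (All.zipWith (λ {c} ((_ , ic) , C) → ▸-cutEdges c ts (subst (λ w → IsCut w c) (sym (singleton-width t)) ic) C)
      (innerCuts-isCut t , innerCuts-edges o t)))
    (++-cutEdges o [ t ] ts ∷ Allₚ.map⁺ (All.map (λ {c} → ◂-cutEdges t c) (cuts-edges (o + leaves t) ts)))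

  position : Cut → ℕ
  position (u , _) = width u

  applyUpTo-+ : ∀ {A : Set} (f : ℕ → A) m n → applyUpTo f (m + n) ≡ applyUpTo f m ++ applyUpTo (λ k → f (m + k)) n
  applyUpTo-+ f zero    n = refl
  applyUpTo-+ f (suc m) n = cong (f 0 ∷_) (applyUpTo-+ (f ∘ suc) m n)

  upTo-suc-+ : ∀ m n → applyUpTo suc (m + n) ≡ applyUpTo suc m ++ map (m +_) (applyUpTo suc n)
  upTo-suc-+ m n = trans (applyUpTo-+ suc m n) (cong (applyUpTo suc m ++_)
    (trans (go m n) (sym (map-applyUpTo suc (m +_) n))))
    where
    cong-upTo : ∀ {A : Set} {f h : ℕ → A} → (∀ k → f k ≡ h k) → ∀ n → applyUpTo f n ≡ applyUpTo h n
    cong-upTo e zero    = refl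
    cong-upTo e (suc n) = cong₂ _∷_ (e 0) (cong-upTo (e ∘ suc) n)
    go : ∀ m n → applyUpTo (λ k → suc (m + k)) n ≡ applyUpTo (λ k → m + suc k) n
    go m n = cong-upTo (λ k → sym (+-suc m k)) n

  map-position-▸ : ∀ ts cs → map position (map (_▸ ts) cs) ≡ map position cs
  map-position-▸ ts cs = sym (map-∘ cs)

  map-position-◂ : ∀ t cs → map position (map ([ t ] ◂_) cs) ≡ map (leaves t +_) (map position cs)
  map-position-◂ t cs = trans (sym (map-∘ cs)) (map-∘ cs)

  innerCuts-positions : ∀ t → map position (innerCuts t) ++ [ leaves t ] ≡ applyUpTo suc (leaves t)
  innerCuts-positions leaf       = refl
  innerCuts-positions (node l r) = begin
    map position (A ++ ([ l ] , [ r ]) ∷ B) ++ [ leaves l + leaves r ]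
      ≡⟨ cong (_++ [ leaves l + leaves r ]) (map-++ position A (([ l ] , [ r ]) ∷ B)) ⟩
    (map position A ++ width [ l ] ∷ map position B) ++ [ leaves l + leaves r ]
      ≡⟨ ++-assoc (map position A) _ _ ⟩
    map position A ++ width [ l ] ∷ map position B ++ [ leaves l + leaves r ]
      ≡⟨ cong₂ (λ a b → a ++ b ∷ map position B ++ [ leaves l + leaves r ])
           (map-position-▸ [ r ] (innerCuts l)) (singleton-width l) ⟩
    map position (innerCuts l) ++ leaves l ∷ map position B ++ [ leaves l + leaves r ]
      ≡⟨ ++-assoc (map position (innerCuts l)) [ leaves l ] _ ⟨
    (map position (innerCuts l) ++ [ leaves l ]) ++ map position B ++ [ leaves l + leaves r ]
      ≡⟨ cong₂ _++_ (innerCuts-positions l) (trans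
           (cong (_++ [ leaves l + leaves r ]) (map-position-◂ l (innerCuts r)))
           (trans (sym (map-++ (leaves l +_) (map position (innerCuts r)) [ leaves r ]))
                  (cong (map (leaves l +_)) (innerCuts-positions r)))) ⟩
    applyUpTo suc (leaves l) ++ map (leaves l +_) (applyUpTo suc (leaves r))
      ≡⟨ upTo-suc-+ (leaves l) (leaves r) ⟨
    applyUpTo suc (leaves l + leaves r) ∎
    where
    open ≡-Reasoning
    A = map (_▸ [ r ]) (innerCuts l)
    B = map ([ l ] ◂_) (innerCuts r)

  -- Completeness needs a cut at every vertex (`cutAt`), and absence of repetitions needs at most
  -- one (`cuts-distinct`); both are read off this list.
  cuts-positions : ∀ ts → map position (cuts ts) ≡ applyUpTo suc (width ts)
  cuts-positions []       = refl
  cuts-positions (t ∷ ts) = begin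
    map position (A ++ ([ t ] , ts) ∷ B)
      ≡⟨ map-++ position A (([ t ] , ts) ∷ B) ⟩
    map position A ++ width [ t ] ∷ map position B
      ≡⟨ cong₂ (λ a b → a ++ b ∷ map position B) (map-position-▸ ts (innerCuts t)) (singleton-width t) ⟩
    map position (innerCuts t) ++ leaves t ∷ map position B
      ≡⟨ ++-assoc (map position (innerCuts t)) [ leaves t ] _ ⟨
    (map position (innerCuts t) ++ [ leaves t ]) ++ map position B
      ≡⟨ cong₂ _++_ (innerCuts-positions t)
           (trans (map-position-◂ t (cuts ts)) (cong (map (leaves t +_)) (cuts-positions ts))) ⟩
    applyUpTo suc (leaves t) ++ map (leaves t +_) (applyUpTo suc (width ts))
      ≡⟨ upTo-suc-+ (leaves t) (width ts) ⟨
    applyUpTo suc (leaves t + width ts) ∎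
    where
    open ≡-Reasoning
    A = map (_▸ ts) (innerCuts t)
    B = map ([ t ] ◂_) (cuts ts)

  cutAt : ∀ ts {k} → 1 ≤ k → k ≤ width ts → ∃ λ c → c ∈ cuts ts × k ≡ position c
  cutAt ts {suc k} _ k< = ∈-map⁻ position (subst (suc k ∈_) (sym (cuts-positions ts)) (∈-applyUpTo⁺ suc k<))

  cuts-distinct : ∀ ts → AllPairs (λ c c′ → position c ≢ position c′) (cuts ts)
  cuts-distinct ts = AllPairsₚ.map⁻ (subst Unique (sym (cuts-positions ts))
    (Uniqueₚ.applyUpTo⁺₁ suc (width ts) (λ i<j _ → <⇒≢ (s≤s i<j))))

  Avoids : ℕ → Tree → Forest → Set
  Avoids o t ts = ∀ {x y} → Edge o t x y → ¬ ForestEdge o ts x y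

  -- Every edge stays within one tree of the forest. So with two trees or more, the root of a tree
  -- over the forest is never forbidden.
  no-root : ∀ s t ts → ¬ ForestEdge o (s ∷ t ∷ ts) o (o + width (s ∷ t ∷ ts))
  no-root {o} s t ts (here e)  = <⇒≱ (+-monoʳ-< o (m<m+n (leaves s) (≤-trans (leaves≥1 t) (m≤m+n _ _)))) (Edge-≤ s e)
  no-root {o} s t ts (there e) = <⇒≱ (m<m+n o (leaves≥1 s)) (ForestEdge-≥ (t ∷ ts) e)

  pairs : ℕ → Cut → List Tree
  pairs f (u , v) = cartesianProductWith node (avoiders f u) (avoiders f v)

  avoiders-leaves : ∀ f ts {t} → t ∈ avoiders f ts → leaves t ≡ width ts
  avoiders-leaves f (leaf ∷ []) (here refl) = refl
  avoiders-leaves (suc f) ts@(_ ∷ _ ∷ _) t∈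
    with (u , v) , c∈ , t∈′ ← find (∈-concatMap⁻ (pairs f) {xs = cuts ts} t∈)
    with a , b , a∈ , b∈ , refl ← ∈-cartesianProductWith⁻ node (avoiders f u) (avoiders f v) t∈′ =
    trans (cong₂ _+_ (avoiders-leaves f u a∈) (avoiders-leaves f v b∈)) (proj₂ (All.lookup (cuts-isCut ts) c∈))

  avoiders-sound : ∀ f o ts {t} → t ∈ avoiders f ts → Avoids o t ts
  avoiders-sound f o (leaf ∷ []) (here refl) ()
  avoiders-sound (suc f) o ts@(_ ∷ _ ∷ _) t∈ {x} {y} e e′
    with (u , v) , c∈ , t∈′ ← find (∈-concatMap⁻ (pairs f) {xs = cuts ts} t∈)
    with a , b , a∈ , b∈ , refl ← ∈-cartesianProductWith⁻ node (avoiders f u) (avoiders f v) t∈′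
    = go e
    where
    C = All.lookup (cuts-edges o ts) c∈
    la = avoiders-leaves f u a∈
    go : ¬ Edge o (node a b) x y
    go (root x≡ y≡) = no-root _ _ _ (subst₂ (ForestEdge o ts) x≡ (trans y≡ (cong (o +_) (avoiders-leaves (suc f) ts t∈))) e′)
    go (left e)     = avoiders-sound f o u a∈ e (toˡ C e′ (subst (λ z → y ≤ o + z) la (Edge-≤ a e)))
    go (right e)    = avoiders-sound f (o + width u) v b∈ e″ (toʳ C e′ (Edge-≥ b e″))
      where e″ = subst (λ z → Edge (o + z) b x y) la e

  -- The root of `t` splits its leaves at a vertex where `ts` has a cut. The children avoid the two
  -- parts because every edge of a part is an edge of `ts`.
  avoiders-complete : ∀ f o ts → width ts ≤ f → ∀ t → leaves t ≡ width ts → Avoids o t ts → t ∈ avoiders f ts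
  avoiders-complete f o [] _ t lt _ = ⊥-elim (<-irrefl (sym lt) (leaves≥1 t))
  avoiders-complete f o (leaf ∷ []) _ leaf _ _ = here refl
  avoiders-complete f o (leaf ∷ []) _ (node a b) lt _ = ⊥-elim (<-irrefl (sym lt) (+-mono-≤ (leaves≥1 a) (leaves≥1 b)))
  avoiders-complete f o (node l r ∷ []) _ leaf lt _ =
    ⊥-elim (<-irrefl lt (subst (2 ≤_) (sym (+-identityʳ _)) (+-mono-≤ (leaves≥1 l) (leaves≥1 r))))
  avoiders-complete f o (node l r ∷ []) _ (node a b) lt av =
    ⊥-elim (av (root refl refl) (here (root refl (cong (o +_) (trans lt (+-identityʳ _))))))
  avoiders-complete f o (s ∷ s′ ∷ ts) _ leaf lt _ =
    ⊥-elim (<-irrefl lt (+-mono-≤ (leaves≥1 s) (≤-trans (leaves≥1 s′) (m≤m+n _ _))))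
  avoiders-complete zero o (s ∷ _ ∷ ts) w≤ (node a b) lt av =
    ⊥-elim (<⇒≱ (≤-trans (leaves≥1 s) (m≤m+n _ _)) w≤)
  avoiders-complete (suc f) o ts@(_ ∷ _ ∷ _) w≤ (node a b) lt av
    with (u , v) , c∈ , la ← cutAt ts (leaves≥1 a) (subst (leaves a ≤_) lt (m≤m+n (leaves a) (leaves b))) =
    ∈-concatMap⁺ (pairs f) {xs = cuts ts} (lose c∈ (∈-cartesianProductWith⁺ node
      (avoiders-complete f o u (s≤s⁻¹ (≤-trans u< w≤)) a la (λ e e′ → av (left e) (fromˡ C e′)))
      (avoiders-complete f (o + width u) v (s≤s⁻¹ (≤-trans (cut-right< u v ic) w≤)) b lb
        (λ {x} {y} e e′ → av (right (subst (λ z → Edge (o + z) b x y) (sym la) e)) (fromʳ C e′)))))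
    where
    C = All.lookup (cuts-edges o ts) c∈
    ic = All.lookup (cuts-isCut ts) c∈
    lb : leaves b ≡ width v
    lb = +-cancelˡ-≡ (width u) _ _ (trans (cong (_+ leaves b) (sym la)) (trans lt (sym (proj₂ ic))))
    u< : width u < width ts
    u< = subst₂ _<_ la lt (m<m+n (leaves a) (leaves≥1 b))

  avoiders-unique : ∀ f ts → Unique (avoiders f ts)
  avoiders-unique f       []              = []
  avoiders-unique f       (leaf ∷ [])     = [] ∷ []
  avoiders-unique f       (node _ _ ∷ []) = []
  avoiders-unique zero    (_ ∷ _ ∷ _)     = []
  avoiders-unique (suc f) ts@(_ ∷ _ ∷ _)  = Uniqueₚ.concat⁺
    (Allₚ.map⁺ (All.universal (λ (u , v) → Uniqueₚ.cartesianProductWith⁺ node (λ where refl → refl , refl)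
      (avoiders-unique f u) (avoiders-unique f v)) (cuts ts)))
    (AllPairsₚ.map⁺ (AllPairs.map (λ {c} {c′} → disjoint c c′) (cuts-distinct ts)))
    where
    disjoint : ∀ c c′ → position c ≢ position c′ → Disjoint (pairs f c) (pairs f c′)
    disjoint (u , v) (u′ , v′) c≢c′ (t∈ , t∈′)
      with a , b , a∈ , _ , refl ← ∈-cartesianProductWith⁻ node (avoiders f u) (avoiders f v) t∈
      with a′ , b′ , a′∈ , _ , refl ← ∈-cartesianProductWith⁻ node (avoiders f u′) (avoiders f v′) t∈′ =
      c≢c′ (trans (sym (avoiders-leaves f u a∈)) (avoiders-leaves f u′ a′∈))

  -- If `a′` is a node, its root starts at `o`. In `node a b` only the root and edges of `a` start
  -- there, and the root is too long.
  ≤-left : ∀ {o a b a′ b′} → leaves a + leaves b ≡ leaves a′ + leaves b′ →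
    (∀ {x y} → Edge o (node a′ b′) x y → Edge o (node a b) x y) → leaves a′ ≤ leaves a
  ≤-left {a = a} {a′ = leaf} w≡ s = leaves≥1 a
  ≤-left {o} {a} {b} {a′@(node _ _)} {b′} w≡ s with s (left (root refl refl))
  ... | left e  = +-cancelˡ-≤ o _ _ (Edge-≤ a e)
  ... | right e = ⊥-elim (<⇒≱ (m<m+n o (leaves≥1 a)) (Edge-≥ b e))
  ... | root _ e = ⊥-elim (<-irrefl (trans (+-cancelˡ-≡ o _ _ e) w≡) (m<m+n (leaves a′) (leaves≥1 b′)))

  tree-ext : ∀ o t t′ → leaves t ≡ leaves t′ →
    (∀ {x y} → Edge o t x y → Edge o t′ x y) → (∀ {x y} → Edge o t′ x y → Edge o t x y) → t ≡ t′
  tree-ext o leaf leaf _ _ _ = refl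
  tree-ext o leaf (node _ _) _ _ s′ with () ← s′ (root refl refl)
  tree-ext o (node _ _) leaf _ s _ with () ← s (root refl refl)
  tree-ext o (node a b) (node a′ b′) w≡ s s′ = cong₂ node
    (tree-ext o a a′ la (goˡ la s) (goˡ (sym la) s′))
    (tree-ext (o + leaves a) b b′ lb (λ {x} {y} e → subst (λ z → Edge (o + z) b′ x y) (sym la) (goʳ la s e))
      (λ {x} {y} e → goʳ (sym la) s′ (subst (λ z → Edge (o + z) b′ x y) la e)))
    where
    la : leaves a ≡ leaves a′
    la = ≤-antisym (≤-left {b = b′} {b′ = b} (sym w≡) s) (≤-left {b = b} {b′ = b′} w≡ s′)
    lb : leaves b ≡ leaves b′
    lb = +-cancelˡ-≡ (leaves a) _ _ (trans w≡ (cong (_+ leaves b′) (sym la)))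
    goˡ : ∀ {a b a′ b′ x y} → leaves a ≡ leaves a′ →
      (∀ {x y} → Edge o (node a b) x y → Edge o (node a′ b′) x y) → Edge o a x y → Edge o a′ x y
    goˡ {a} {b} {a′} {b′} la s e with s (left e)
    ... | left e′ = e′
    ... | right e′ = ⊥-elim (<⇒≱ (<-≤-trans (Edge-< a e) (Edge-≤ a e)) (subst (λ z → o + z ≤ _) (sym la) (Edge-≥ b′ e′)))
    ... | root _ refl = ⊥-elim (<⇒≱ (subst (λ z → o + z < o + (leaves a′ + leaves b′)) (sym la)
      (+-monoʳ-< o (m<m+n (leaves a′) (leaves≥1 b′)))) (Edge-≤ a e))
    goʳ : ∀ {a b a′ b′ x y} → leaves a ≡ leaves a′ →
      (∀ {x y} → Edge o (node a b) x y → Edge o (node a′ b′) x y) →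
      Edge (o + leaves a) b x y → Edge (o + leaves a′) b′ x y
    goʳ {a} {b} {a′} {b′} la s e with s (right e)
    ... | right e′ = e′
    ... | left e′ = ⊥-elim (<⇒≱ (<-≤-trans (Edge-< b e) (Edge-≤ a′ e′)) (subst (λ z → o + z ≤ _) la (Edge-≥ b e)))
    ... | root refl _ = ⊥-elim (<⇒≱ (m<m+n o (leaves≥1 a)) (Edge-≥ b e))

-- Triangulations of the polygon correspond to trees.

module Triangulations where

  open Forests using (Tree; leaf; node; leaves; leaves≥1)
  open Cores
  open Avoiders
  open import Data.Nat.Base hiding (∣_-_∣)
  open import Data.Nat.Properties renaming (_≟_ to _≟ℕ_; _≤?_ to _≤ℕ?_) hiding (_<?_)
  open import Data.Fin.Base using (Fin; zero; suc; toℕ; fromℕ<)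
  open import Data.Fin.Properties using (_≟_; any?; _<?_; _≤?_; toℕ-injective; toℕ-fromℕ<; toℕ<n)
  open import Data.Fin.Subset using (Subset; inside; outside; _∈_; _∉_; ⁅_⁆; ∣_∣; _-_; Empty)
  open import Data.Fin.Subset.Properties using (_∈?_; ∣⊥∣≡0; Empty-unique; x∈p∧x≢y⇒x∈p-y; p─q⊆p; p─⊥≡p; x∈p⇒∣p-x∣<∣p∣)
  open import Data.List.Base using (List; []; _∷_; length)
  open import Data.List.Membership.Propositional using () renaming (_∈_ to _∈ₗ_)
  open import Data.List.Relation.Unary.All as All using (All; []; _∷_)
  open import Data.List.Relation.Unary.Any using (here; there)
  open import Data.List.Relation.Unary.AllPairs using ([]; _∷_)
  open import Data.List.Relation.Unary.Unique.Propositional using (Unique)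
  open import Data.Product.Base using (_×_; _,_; proj₁; proj₂; ∃; ∃₂)
  open import Data.Sum.Base using (_⊎_; inj₁; inj₂)
  open import Data.Empty using (⊥-elim)
  import Data.Vec.Base as Vec
  open import Data.Vec.Properties using (lookup∘tabulate; []=⇒lookup; lookup⇒[]=)
  open import Function.Base using (_∘_)
  open import Relation.Nullary.Decidable using (Dec; yes; no; does; ¬?; _×-dec_; _⊎-dec_; map′; dec-true; decidable-stable)
  open import Relation.Nullary.Negation.Core using (¬_; contradiction)
  open import Relation.Unary using (Decidable)
  open import Relation.Binary.Definitions using (tri<; tri≈; tri>)
  open import Relation.Binary.PropositionalEquality hiding ([_])

  private
    variable
      m : ℕ

  least : ∀ {P : Fin m → Set} → Decidable P → ∃ P → ∃ λ i → P i × (∀ j → P j → toℕ i ≤ toℕ j)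
  least {suc m} {P} P? (i , Pi) with P? zero
  ... | yes P0 = zero , P0 , λ _ _ → z≤n
  ... | no ¬P0 with i
  ...   | zero   = contradiction Pi ¬P0
  ...   | suc i′ with least (P? ∘ suc) (i′ , Pi)
  ...     | k , Pk , min = suc k , Pk , λ where
              zero    P0 → contradiction P0 ¬P0
              (suc j) Pj → s≤s (min j Pj)

  greatest : ∀ {P : Fin m → Set} → Decidable P → ∃ P → ∃ λ i → P i × (∀ j → P j → toℕ j ≤ toℕ i)
  greatest {suc m} {P} P? (i , Pi) with any? (P? ∘ suc)
  ... | yes e with greatest (P? ∘ suc) e
  ...   | k , Pk , max = suc k , Pk , λ where
            zero    _  → z≤n
            (suc j) Pj → s≤s (max j Pj)
  greatest {suc m} {P} P? (suc i , Pi) | no ¬e = contradiction (i , Pi) ¬e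
  greatest {suc m} {P} P? (zero  , Pi) | no ¬e = zero , Pi , λ where
    zero    _  → z≤n
    (suc j) Pj → contradiction (j , Pj) ¬e

  toℕ<⇒≢ : ∀ {x y : Fin m} → toℕ x < toℕ y → x ≢ y
  toℕ<⇒≢ p refl = <-irrefl refl p

  fromPred : ∀ {P : Fin m → Set} → Decidable P → Subset m
  fromPred P? = Vec.tabulate (does ∘ P?)

  ∈-fromPred⁺ : ∀ {P : Fin m → Set} (P? : Decidable P) {i} → P i → i ∈ fromPred P?
  ∈-fromPred⁺ P? {i} Pi = lookup⇒[]= i _ (trans (lookup∘tabulate _ i) (dec-true (P? i) Pi))

  ∈-fromPred⁻ : ∀ {P : Fin m → Set} (P? : Decidable P) {i} → i ∈ fromPred P? → P i
  ∈-fromPred⁻ P? {i} i∈ with P? i | trans (sym (lookup∘tabulate (does ∘ P?) i)) ([]=⇒lookup i∈)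
  ... | yes Pi | _ = Pi
  ... | no _   | ()

  ∣p∣≤1+∣p-x∣ : ∀ (p : Subset m) x → ∣ p ∣ ≤ suc ∣ p - x ∣
  ∣p∣≤1+∣p-x∣ (inside  Vec.∷ p) zero    = s≤s (≤-reflexive (cong ∣_∣ (sym (p─⊥≡p p))))
  ∣p∣≤1+∣p-x∣ (outside Vec.∷ p) zero    = ≤-trans (≤-reflexive (cong ∣_∣ (sym (p─⊥≡p p)))) (n≤1+n _)
  ∣p∣≤1+∣p-x∣ (inside  Vec.∷ p) (suc x) = s≤s (∣p∣≤1+∣p-x∣ p x)
  ∣p∣≤1+∣p-x∣ (outside Vec.∷ p) (suc x) = ∣p∣≤1+∣p-x∣ p x

  x∉p-x : ∀ (p : Subset m) x → x ∉ p - x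
  x∉p-x (_ Vec.∷ p) (suc x) (Vec.there x∈) = x∉p-x p x x∈

  ∣p∣≤length : ∀ (xs : List (Fin m)) p → (∀ {z} → z ∈ p → z ∈ₗ xs) → ∣ p ∣ ≤ length xs
  ∣p∣≤length {m} [] p p⊆ = ≤-reflexive (trans (cong ∣_∣ (Empty-unique λ (z , z∈) → ∉[] (p⊆ z∈))) (∣⊥∣≡0 m))
    where
    ∉[] : ∀ {z : Fin m} → ¬ z ∈ₗ []
    ∉[] ()
  ∣p∣≤length (x ∷ xs) p p⊆ = ≤-trans (∣p∣≤1+∣p-x∣ p x) (s≤s (∣p∣≤length xs (p - x) sub))
    where
    sub : ∀ {z} → z ∈ p - x → z ∈ₗ xs
    sub z∈ with p⊆ (p─q⊆p p ⁅ x ⁆ z∈)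
    ... | here refl = contradiction z∈ (x∉p-x p x)
    ... | there z∈′ = z∈′

  length≤∣p∣ : ∀ {xs : List (Fin m)} {p} → Unique xs → All (_∈ p) xs → length xs ≤ ∣ p ∣
  length≤∣p∣ [] [] = z≤n
  length≤∣p∣ {p = p} (x∉ ∷ u) (x∈ ∷ xs∈) = ≤-trans
    (s≤s (length≤∣p∣ u (All.zipWith (λ (x≢z , z∈) → x∈p∧x≢y⇒x∈p-y z∈ (x≢z ∘ sym)) (x∉ , xs∈))))
    (x∈p⇒∣p-x∣<∣p∣ x∈)

  Edge-noncrossing : ∀ o t {i j k l} → Edge o t i j → Edge o t k l → i < k → k < j → ¬ j < l
  Edge-noncrossing o t@(node a b) (root _ refl) e _ _ j<l = <⇒≱ j<l (Edge-≤ t e)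
  Edge-noncrossing o t@(node a b) e (root refl _) i<k _ _ = <⇒≱ i<k (Edge-≥ t e)
  Edge-noncrossing o (node a b) (left e)  (left e′)  = Edge-noncrossing o a e e′
  Edge-noncrossing o (node a b) (right e) (right e′) = Edge-noncrossing _ b e e′
  Edge-noncrossing o (node a b) (left e)  (right e′) _ k<j _ = <⇒≱ (<-≤-trans k<j (Edge-≤ a e)) (Edge-≥ b e′)
  Edge-noncrossing o (node a b) (right e) (left e′) i<k k<j j<l =
    <⇒≱ (<-≤-trans (<-trans (<-trans i<k k<j) j<l) (Edge-≤ a e′)) (Edge-≥ b e)

  Edge? : ∀ o t x y → Dec (Edge o t x y)
  Edge? o leaf       x y = no λ ()
  Edge? o (node l r) x y = map′ to from
    (((x ≟ℕ o) ×-dec (y ≟ℕ o + (leaves l + leaves r))) ⊎-dec (Edge? o l x y ⊎-dec Edge? (o + leaves l) r x y))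
    where
    to : _ → Edge o (node l r) x y
    to (inj₁ (p , q))  = root p q
    to (inj₂ (inj₁ e)) = left e
    to (inj₂ (inj₂ e)) = right e
    from : Edge o (node l r) x y → _
    from (root p q) = inj₁ (p , q)
    from (left e)   = inj₂ (inj₁ e)
    from (right e)  = inj₂ (inj₂ e)

  ForestEdge? : ∀ o ts x y → Dec (ForestEdge o ts x y)
  ForestEdge? o []       x y = no λ ()
  ForestEdge? o (t ∷ ts) x y = map′ to from (Edge? o t x y ⊎-dec ForestEdge? (o + leaves t) ts x y)
    where
    to : _ → ForestEdge o (t ∷ ts) x y
    to (inj₁ e) = here e
    to (inj₂ e) = there e
    from : ForestEdge o (t ∷ ts) x y → _
    from (here e)  = inj₁ e
    from (there e) = inj₂ e

  Chord-no-root : ∀ t → ¬ Chord t 0 (leaves t)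
  Chord-no-root (node l r) e =
    no-root l r [] (subst (λ z → ForestEdge 0 (l ∷ r ∷ []) 0 (leaves l + z)) (sym (+-identityʳ (leaves r))) e)

  Edge⇒Chord : ∀ t {x y} → Edge 0 t x y → (x ≡ 0 × y ≡ leaves t) ⊎ Chord t x y
  Edge⇒Chord (node l r) (root p q) = inj₁ (p , q)
  Edge⇒Chord (node l r) (left e)   = inj₂ (here e)
  Edge⇒Chord (node l r) (right e)  = inj₂ (there (here e))

  -- Treats diagonals and sides of the polygon alike: unit intervals are the sides at the leaves,
  -- and the root of the whole tree is the remaining side.
  SideOf : ℕ → Tree → ℕ → ℕ → Set
  SideOf o t x y = suc x ≡ y ⊎ Edge o t x y

  root-side : ∀ o t → SideOf o t o (o + leaves t)
  root-side o leaf       = inj₁ (+-comm 1 o)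
  root-side o (node _ _) = inj₂ (root refl refl)

  apex : ∀ o t {x y} → Edge o t x y → ∃ λ c → x < c × c < y × SideOf o t x c × SideOf o t c y
  apex o (node l r) (root refl refl) =
    o + leaves l , m<m+n o (leaves≥1 l) , +-monoʳ-< o (m<m+n (leaves l) (leaves≥1 r)) ,
    up left (root-side o l) ,
    subst (SideOf o (node l r) (o + leaves l)) (+-assoc o (leaves l) (leaves r)) (up right (root-side (o + leaves l) r))
    where
    up : ∀ {o o′ t t′ x y} → (Edge o t x y → Edge o′ t′ x y) → SideOf o t x y → SideOf o′ t′ x y
    up f (inj₁ p) = inj₁ p
    up f (inj₂ e) = inj₂ (f e)
  apex o (node l r) (left e) with apex o l e
  ... | c , x<c , c<y , s , s′ = c , x<c , c<y , up s , up s′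
    where
    up : ∀ {x y} → SideOf o l x y → SideOf o (node l r) x y
    up (inj₁ p) = inj₁ p
    up (inj₂ e) = inj₂ (left e)
  apex o (node l r) (right e) with apex (o + leaves l) r e
  ... | c , x<c , c<y , s , s′ = c , x<c , c<y , up s , up s′
    where
    up : ∀ {x y} → SideOf (o + leaves l) r x y → SideOf o (node l r) x y
    up (inj₁ p) = inj₁ p
    up (inj₂ e) = inj₂ (right e)

  module _ (n : ℕ) where
    open Polygon n

    record Represents (D : SegmentSet) (t : Tree) : Set where
      constructor represents
      field
        size  : suc (leaves t) ≡ n
        sound : ∀ {i j} → Contains D i j → Chord t (toℕ i) (toℕ j)
        full  : ∀ {i j} → Chord t (toℕ i) (toℕ j) → Contains D i j

    module FromTree {D : SegmentSet} {t : Tree} (R : Represents D t) where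
      open Represents R

      toℕ≤ : ∀ (i : Vertex) → toℕ i ≤ leaves t
      toℕ≤ i = s≤s⁻¹ (subst (toℕ i <_) (sym size) (toℕ<n i))

      allDiagonals : AllDiagonals D
      allDiagonals i j c = Edge-< t e , notSide
        where
        e = Chord⇒Edge {t} (sound c)
        notSide : ¬ Side i j
        notSide (_ , inj₁ p) = <-irrefl (sym p) (Edge-long t e)
        notSide (_ , inj₂ (p , q)) = Chord-no-root t (subst₂ (Chord t) p (suc-injective (trans q (sym size))) (sound c))

      noCrossing : NonCrossing D
      noCrossing i j c k l c′ (inj₁ (p , q , r)) =
        Edge-noncrossing 0 t (Chord⇒Edge {t} (sound c)) (Chord⇒Edge {t} (sound c′)) p q r
      noCrossing i j c k l c′ (inj₂ (p , q , r)) =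
        Edge-noncrossing 0 t (Chord⇒Edge {t} (sound c′)) (Chord⇒Edge {t} (sound c)) p q r

      sideOf : ∀ {i j} → Side i j ⊎ Contains D i j → SideOf 0 t (toℕ i) (toℕ j)
      sideOf (inj₁ (_ , inj₁ p))       = inj₁ (sym p)
      sideOf (inj₁ (_ , inj₂ (p , q))) = subst₂ (SideOf 0 t) (sym p) (sym (suc-injective (trans q (sym size)))) (root-side 0 t)
      sideOf (inj₂ c)                  = inj₂ (Chord⇒Edge {t} (sound c))

      chord : ∀ {x y} → suc x < y → SideOf 0 t x y → (x ≡ 0 × y ≡ leaves t) ⊎ Chord t x y
      chord l (inj₁ refl) = contradiction l (<-irrefl refl)
      chord l (inj₂ e)    = Edge⇒Chord t e

      module _ {S : Subset n} (S-region : Region D S) where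
        private
          3≤∣S∣ = proj₁ S-region

          third : ∀ a b → ∃ λ z → z ∈ S × z ≢ a × z ≢ b
          third a b with any? (λ z → (z ∈? S) ×-dec ¬? (z ≟ a) ×-dec ¬? (z ≟ b))
          ... | yes e = e
          ... | no ¬e = contradiction 3≤∣S∣ (<⇒≱ (s≤s (∣p∣≤length (a ∷ b ∷ []) S two)))
            where
            two : ∀ {z} → z ∈ S → z ∈ₗ a ∷ b ∷ []
            two {z} z∈ with z ≟ a | z ≟ b
            ... | yes p | _     = here p
            ... | no _  | yes p = there (here p)
            ... | no p  | no q  = contradiction (z , z∈ , p , q) ¬e

          some : ∃ (_∈ S)
          some with any? (_∈? S)
          ... | yes e = e
          ... | no ¬e = contradiction 3≤∣S∣ (<⇒≱ (s≤s (≤-trans (∣p∣≤length [] S (λ z∈ → ⊥-elim (¬e (_ , z∈)))) z≤n)))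

          consecutive-side : ∀ {i j} → i ∈ S → j ∈ S → toℕ i < toℕ j → Consecutive S i j → SideOf 0 t (toℕ i) (toℕ j)
          consecutive-side i∈ j∈ i<j c = sideOf (proj₁ (proj₂ S-region _ i∈ _ j∈ i<j) c)

          module Triangular (a b m : Vertex) (a∈ : a ∈ S) (a-min : ∀ j → j ∈ S → toℕ a ≤ toℕ j)
            (b∈ : b ∈ S) (b-max : ∀ j → j ∈ S → toℕ j ≤ toℕ b) (m∈ : m ∈ S) (a<m : toℕ a < toℕ m) (m<b : toℕ m < toℕ b)
            (c : Vertex) (a<c : toℕ a < toℕ c) (c<b : toℕ c < toℕ b)
            (ac : SideOf 0 t (toℕ a) (toℕ c)) (cb : SideOf 0 t (toℕ c) (toℕ b)) where

            -- If `c` were missing, its neighbours i < c < j in `S` would be joined. To cross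
            -- neither `a c` nor `c b` they would have to be `a` and `b`, but `m` lies between
            -- these.
            c∈ : c ∈ S
            c∈ = decidable-stable (c ∈? S) λ c∉ →
              let i , (i∈ , i<c) , i-max = greatest (λ z → (z ∈? S) ×-dec (z <? c)) (a , a∈ , a<c)
                  j , (j∈ , c<j) , j-min = least (λ z → (z ∈? S) ×-dec (c <? z)) (b , b∈ , c<b)
                  gap : ∀ k → k ∈ S → ¬ (toℕ i < toℕ k × toℕ k < toℕ j)
                  gap k k∈ (i<k , k<j) = case-< k c
                    (λ k<c → <⇒≱ i<k (i-max k (k∈ , k<c)))
                    (λ k≡c → c∉ (subst (_∈ S) k≡c k∈))
                    (λ c<k → <⇒≱ k<j (j-min k (k∈ , c<k)))
                  ij : SideOf 0 t (toℕ i) (toℕ j)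
                  ij = consecutive-side i∈ j∈ (<-trans i<c c<j) (inj₁ gap)
                  a≡i : toℕ a ≡ toℕ i
                  a≡i = ≤-antisym (a-min i i∈) (≮⇒≥ λ a<i → cross ac ij a<i i<c c<j)
                  b≡j : toℕ b ≡ toℕ j
                  b≡j = ≤-antisym (≮⇒≥ λ j<b → cross ij cb i<c c<j j<b) (b-max j j∈)
              in gap m m∈ (subst (_< toℕ m) a≡i a<m , subst (toℕ m <_) b≡j m<b)
              where
              case-< : ∀ (k c : Vertex) {A : Set} → (toℕ k < toℕ c → A) → (k ≡ c → A) → (toℕ c < toℕ k → A) → A
              case-< k c f g h with <-cmp (toℕ k) (toℕ c)
              ... | tri< p _ _ = f p
              ... | tri≈ _ p _ = g (toℕ-injective p)
              ... | tri> _ _ p = h p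
              cross : ∀ {x y z w} → SideOf 0 t x y → SideOf 0 t z w → x < z → z < y → ¬ y < w
              cross (inj₁ refl) _ x<z z<y _ = <⇒≱ x<z (s≤s⁻¹ z<y)
              cross _ (inj₁ refl) _ z<y y<w = <⇒≱ z<y (s≤s⁻¹ y<w)
              cross (inj₂ e) (inj₂ e′) = Edge-noncrossing 0 t e e′

            -- With `z` in between, `a c` is no side of the polygon, hence a member of `D`, and a
            -- region has no diagonal in `D`. The other boundary arc is not free either, because it
            -- contains `b`.
            ac-empty : ∀ z → z ∈ S → toℕ a < toℕ z → ¬ toℕ z < toℕ c
            ac-empty z z∈ a<z z<c with chord (≤-trans (s≤s a<z) z<c) ac
            ... | inj₁ (_ , p) = <-irrefl p (<-≤-trans c<b (toℕ≤ b))
            ... | inj₂ e with proj₂ (proj₂ S-region a a∈ c c∈ a<c) (full e)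
            ...   | inj₁ f = f z z∈ (a<z , z<c)
            ...   | inj₂ f = f b b∈ (inj₂ c<b)

            cb-empty : ∀ z → z ∈ S → toℕ c < toℕ z → ¬ toℕ z < toℕ b
            cb-empty z z∈ c<z z<b with chord (≤-trans (s≤s c<z) z<b) cb
            ... | inj₁ (p , _) = <⇒≱ (≤-<-trans z≤n a<c) (≤-reflexive p)
            ... | inj₂ e with proj₂ (proj₂ S-region c c∈ b b∈ c<b) (full e)
            ...   | inj₁ f = f z z∈ (c<z , z<b)
            ...   | inj₂ f = f a a∈ (inj₁ a<c)

            three : ∀ {z} → z ∈ S → z ∈ₗ a ∷ c ∷ b ∷ []
            three {z} z∈ with <-cmp (toℕ z) (toℕ a) | <-cmp (toℕ z) (toℕ c) | <-cmp (toℕ z) (toℕ b)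
            ... | tri< p _ _ | _ | _ = contradiction (a-min z z∈) (<⇒≱ p)
            ... | tri≈ _ p _ | _ | _ = here (toℕ-injective p)
            ... | _ | tri≈ _ p _ | _ = there (here (toℕ-injective p))
            ... | _ | _ | tri≈ _ p _ = there (there (here (toℕ-injective p)))
            ... | _ | _ | tri> _ _ p = contradiction (b-max z z∈) (<⇒≱ p)
            ... | tri> _ _ p | tri< q _ _ | _ = contradiction q (ac-empty z z∈ p)
            ... | _ | tri> _ _ p | tri< q _ _ = contradiction q (cb-empty z z∈ p)

        -- The least and greatest vertices of `S` are neighbours around the outside, so they are
        -- joined by an edge of the tree. The apex below that edge turns out to be the only other
        -- vertex of `S`.
        region-size : ∣ S ∣ ≡ 3
        region-size with least (_∈? S) some | greatest (_∈? S) some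
        ... | a , a∈ , a-min | b , b∈ , b-max with third a b
        ...   | m , m∈ , m≢a , m≢b = ≤-antisym (at-most outer) 3≤∣S∣
          where
          a<m : toℕ a < toℕ m
          a<m = ≤∧≢⇒< (a-min m m∈) (m≢a ∘ sym ∘ toℕ-injective)
          m<b : toℕ m < toℕ b
          m<b = ≤∧≢⇒< (b-max m m∈) (m≢b ∘ toℕ-injective)
          outer : SideOf 0 t (toℕ a) (toℕ b)
          outer = consecutive-side a∈ b∈ (<-trans a<m m<b)
            (inj₂ λ k k∈ → λ { (inj₁ p) → <⇒≱ p (a-min k k∈) ; (inj₂ p) → <⇒≱ p (b-max k k∈) })
          at-most : SideOf 0 t (toℕ a) (toℕ b) → ∣ S ∣ ≤ 3
          at-most (inj₁ p) = contradiction (≤-trans (s≤s a<m) m<b) (<-irrefl p)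
          at-most (inj₂ e) with apex 0 t e
          ... | c , a<c , c<b , ac , cb = ∣p∣≤length (a ∷ fromℕ< c<n ∷ b ∷ []) S
            (Triangular.three a b m a∈ a-min b∈ b-max m∈ a<m m<b (fromℕ< c<n)
              (subst (toℕ a <_) c≡ a<c) (subst (_< toℕ b) c≡ c<b)
              (subst (SideOf 0 t (toℕ a)) c≡ ac) (subst (λ z → SideOf 0 t z (toℕ b)) c≡ cb))
            where
            c<n : c < n
            c<n = <-trans c<b (toℕ<n b)
            c≡ : c ≡ toℕ (fromℕ< c<n)
            c≡ = sym (toℕ-fromℕ< c<n)

      triangulation : Triangulation D
      triangulation = allDiagonals , noCrossing , λ S → region-size

    SideOrIn : SegmentSet → Vertex → Vertex → Set
    SideOrIn D i j = Side i j ⊎ Contains D i j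

    SideOrIn-< : ∀ {D i j} → AllDiagonals D → SideOrIn D i j → toℕ i < toℕ j
    SideOrIn-< dg (inj₁ s) = proj₁ s
    SideOrIn-< dg (inj₂ c) = proj₁ (dg _ _ c)

    -- The region of D just below i j consists of the vertices which no member of
    -- D other than i j itself separates from i j.
    module BelowEdge {D : SegmentSet} (D-tri : Triangulation D) {i j : Vertex}
      (1+i<j : suc (toℕ i) < toℕ j) (ij : SideOrIn D i j) where

      private
        dg = proj₁ D-tri
        nc = proj₁ (proj₂ D-tri)
        i<j : toℕ i < toℕ j
        i<j = <-trans (n<1+n _) 1+i<j

      Covers : Vertex → Vertex → Vertex → Set
      Covers k x y = Contains D x y × toℕ i ≤ toℕ x × toℕ x < toℕ k × toℕ k < toℕ y × toℕ y ≤ toℕ j × ¬ (x ≡ i × y ≡ j)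

      Covered : Vertex → Set
      Covered k = ∃₂ (Covers k)

      covered? : Decidable Covered
      covered? k = any? λ x → any? λ y → contains? D x y ×-dec (i ≤? x) ×-dec (x <? k) ×-dec (k <? y) ×-dec (y ≤? j)
        ×-dec ¬? ((x ≟ i) ×-dec (y ≟ j))

      Visible : Vertex → Set
      Visible k = toℕ i ≤ toℕ k × toℕ k ≤ toℕ j × ¬ Covered k

      visible? : Decidable Visible
      visible? k = (i ≤? k) ×-dec (k ≤? j) ×-dec ¬? (covered? k)

      S : Subset n
      S = fromPred visible?

      ∈⁺ : ∀ {k} → Visible k → k ∈ S
      ∈⁺ = ∈-fromPred⁺ visible?

      ∈⁻ : ∀ {k} → k ∈ S → Visible k
      ∈⁻ = ∈-fromPred⁻ visible?

      hidden⇒covered : ∀ {k} → toℕ i ≤ toℕ k → toℕ k ≤ toℕ j → k ∉ S → Covered k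
      hidden⇒covered {k} p q k∉ = decidable-stable (covered? k) λ ¬c → k∉ (∈⁺ (p , q , ¬c))

      i∈ : i ∈ S
      i∈ = ∈⁺ (≤-refl , <⇒≤ i<j , λ (x , y , _ , i≤x , x<i , _) → <⇒≱ x<i i≤x)

      j∈ : j ∈ S
      j∈ = ∈⁺ (<⇒≤ i<j , ≤-refl , λ (x , y , _ , _ , _ , j<y , y≤j , _) → <⇒≱ j<y y≤j)

      -- Take the far end of the longest member of `D` that starts at `i` and ends before `j`, or
      -- the vertex after `i` if there is none. A member covering it would cross this one, or start
      -- at `i` and be longer.
      inner : ∃ λ c → c ∈ S × toℕ i < toℕ c × toℕ c < toℕ j
      inner with any? (λ y → contains? D i y ×-dec (y <? j))
      ... | yes e with greatest (λ y → contains? D i y ×-dec (y <? j)) e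
      ...   | c , (ic , c<j) , c-max = c , ∈⁺ (<⇒≤ i<c , <⇒≤ c<j , uncovered) , i<c , c<j
        where
        i<c = proj₁ (dg _ _ ic)
        uncovered : ¬ Covered c
        uncovered (x , y , xy , i≤x , x<c , c<y , y≤j , ≢ij) with m≤n⇒m<n∨m≡n i≤x
        ... | inj₁ i<x = nc _ _ ic _ _ xy (inj₁ (i<x , x<c , c<y))
        ... | inj₂ i≡x with refl ← toℕ-injective i≡x =
          <⇒≱ c<y (c-max y (xy , ≤∧≢⇒< y≤j (λ y≡j → ≢ij (refl , toℕ-injective y≡j))))
      inner | no ¬e = c , ∈⁺ (<⇒≤ i<c , <⇒≤ c<j , uncovered) , i<c , c<j
        where
        c<n = <-trans 1+i<j (toℕ<n j)
        c = fromℕ< c<n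
        c≡ : toℕ c ≡ suc (toℕ i)
        c≡ = toℕ-fromℕ< c<n
        i<c : toℕ i < toℕ c
        i<c = ≤-reflexive (sym c≡)
        c<j : toℕ c < toℕ j
        c<j = subst (_< toℕ j) (sym c≡) 1+i<j
        uncovered : ¬ Covered c
        uncovered (x , y , xy , i≤x , x<c , c<y , y≤j , ≢ij)
          with refl ← toℕ-injective (≤-antisym i≤x (s≤s⁻¹ (subst (toℕ x <_) c≡ x<c))) =
          ¬e (y , xy , ≤∧≢⇒< y≤j (λ y≡j → ≢ij (refl , toℕ-injective y≡j)))

      -- Everything between `x` and `y` is covered. If the longest member of `D` from `x` within the
      -- gap stopped at `z` before `y`, a member covering `z` would either cross it or start at `x`
      -- and be longer.
      gap-side : ∀ {x y} → x ∈ S → y ∈ S → toℕ x < toℕ y → ¬ (x ≡ i × y ≡ j) →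
        (∀ k → k ∈ S → ¬ (toℕ x < toℕ k × toℕ k < toℕ y)) → SideOrIn D x y
      gap-side {x} {y} x∈ y∈ x<y ≢ij gap with m≤n⇒m<n∨m≡n x<y
      ... | inj₂ 1+x≡y = inj₁ (x<y , inj₁ (sym 1+x≡y))
      ... | inj₁ 1+x<y = inj₂ (reach (greatest (λ z → contains? D x z ×-dec (z ≤? y)) first))
        where
        i≤x = proj₁ (∈⁻ x∈)
        ¬covx = proj₂ (proj₂ (∈⁻ x∈))
        y≤j = proj₁ (proj₂ (∈⁻ y∈))
        ¬covy = proj₂ (proj₂ (∈⁻ y∈))

        -- A cover of `k` that started before `x` would cover `x`, and one that started at `x` and
        -- ended after `y` would cover `y`; but both are visible.
        from-x : ∀ k → toℕ x < toℕ k → toℕ k < toℕ y → ∃ λ p → ∃ λ q →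
          Contains D p q × toℕ x ≤ toℕ p × toℕ p < toℕ k × toℕ k < toℕ q × (p ≡ x → toℕ q ≤ toℕ y)
        from-x k x<k k<y with hidden⇒covered (≤-trans i≤x (<⇒≤ x<k)) (≤-trans (<⇒≤ k<y) y≤j) (λ k∈ → gap k k∈ (x<k , k<y))
        ... | p , q , pq , i≤p , p<k , k<q , q≤j , ≢ij′ = p , q , pq , x≤p , p<k , k<q , below
          where
          x≤p : toℕ x ≤ toℕ p
          x≤p = ≮⇒≥ λ p<x → ¬covx (p , q , pq , i≤p , p<x , <-trans x<k k<q , q≤j , ≢ij′)
          below : p ≡ x → toℕ q ≤ toℕ y
          below p≡x = ≮⇒≥ λ y<q → ¬covy (p , q , pq , i≤p , subst (λ z → toℕ z < toℕ y) (sym p≡x) x<y , y<q , q≤j , ≢ij′)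

        k<n = <-trans 1+x<y (toℕ<n y)
        k≡ : toℕ (fromℕ< k<n) ≡ suc (toℕ x)
        k≡ = toℕ-fromℕ< k<n

        first : ∃ λ z → Contains D x z × toℕ z ≤ toℕ y
        first with from-x (fromℕ< k<n) (≤-reflexive (sym k≡)) (subst (_< toℕ y) (sym k≡) 1+x<y)
        ... | p , q , pq , x≤p , p<k , k<q , below
          with refl ← toℕ-injective (≤-antisym x≤p (s≤s⁻¹ (subst (toℕ p <_) k≡ p<k))) = q , pq , below refl

        reach : (∃ λ z → (Contains D x z × toℕ z ≤ toℕ y) × (∀ z′ → Contains D x z′ × toℕ z′ ≤ toℕ y → toℕ z′ ≤ toℕ z)) →
          Contains D x y
        reach (z , (xz , z≤y) , z-max) with m≤n⇒m<n∨m≡n z≤y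
        ... | inj₂ z≡y = subst (Contains D x) (toℕ-injective z≡y) xz
        ... | inj₁ z<y with from-x z (proj₁ (dg _ _ xz)) z<y
        ...   | p , q , pq , x≤p , p<z , z<q , below with m≤n⇒m<n∨m≡n x≤p
        ...     | inj₁ x<p = contradiction (inj₁ (x<p , p<z , z<q)) (nc _ _ xz _ _ pq)
        ...     | inj₂ x≡p with refl ← toℕ-injective x≡p = contradiction (z-max q (pq , below refl)) (<⇒≱ z<q)

      S-region : Region D S
      S-region = length≤∣p∣ {xs = i ∷ c ∷ j ∷ []}
          ((toℕ<⇒≢ i<c ∷ toℕ<⇒≢ i<j ∷ []) ∷ (toℕ<⇒≢ c<j ∷ []) ∷ [] ∷ []) (i∈ ∷ c∈ ∷ j∈ ∷ [])
        , λ x x∈ y y∈ x<y → side x x∈ y y∈ x<y , consecutive x x∈ y y∈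
        where
        c = proj₁ inner
        c∈ = proj₁ (proj₂ inner)
        i<c = proj₁ (proj₂ (proj₂ inner))
        c<j = proj₂ (proj₂ (proj₂ inner))
        consecutive : ∀ x → x ∈ S → ∀ y → y ∈ S → Contains D x y → Consecutive S x y
        consecutive x x∈ y y∈ xy with (x ≟ i) ×-dec (y ≟ j)
        ... | yes (refl , refl) = inj₂ λ k k∈ → λ where
          (inj₁ k<i) → <⇒≱ k<i (proj₁ (∈⁻ k∈))
          (inj₂ j<k) → <⇒≱ j<k (proj₁ (proj₂ (∈⁻ k∈)))
        ... | no ≢ij = inj₁ λ k k∈ (x<k , k<y) →
          proj₂ (proj₂ (∈⁻ k∈)) (x , y , xy , proj₁ (∈⁻ x∈) , x<k , k<y , proj₁ (proj₂ (∈⁻ y∈)) , ≢ij)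
        side : ∀ x → x ∈ S → ∀ y → y ∈ S → toℕ x < toℕ y → Consecutive S x y → SideOrIn D x y
        side x x∈ y y∈ x<y con with (x ≟ i) ×-dec (y ≟ j)
        ... | yes (refl , refl) = ij
        ... | no ≢ij with con
        ...   | inj₁ gap = gap-side x∈ y∈ x<y ≢ij gap
        ...   | inj₂ out = contradiction
          (toℕ-injective (≤-antisym (≮⇒≥ (out i i∈ ∘ inj₁)) (proj₁ (∈⁻ x∈))) ,
           toℕ-injective (≤-antisym (proj₁ (proj₂ (∈⁻ y∈))) (≮⇒≥ (out j j∈ ∘ inj₂)))) ≢ij

      -- The region is a triangle, so `S` has no fourth vertex and the inner one is a neighbour of
      -- both `i` and `j`.
      apexVertex : ∃ λ c → toℕ i < toℕ c × toℕ c < toℕ j × SideOrIn D i c × SideOrIn D c j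
      apexVertex = c , i<c , c<j ,
        proj₁ (proj₂ S-region i i∈ c c∈ i<c) (inj₁ λ k k∈ (i<k , k<c) →
          only k k∈ i<k (<-trans k<c c<j) (λ k≡c → <-irrefl (cong toℕ k≡c) k<c)) ,
        proj₁ (proj₂ S-region c c∈ j j∈ c<j) (inj₁ λ k k∈ (c<k , k<j) →
          only k k∈ (<-trans i<c c<k) k<j (λ k≡c → <-irrefl (cong toℕ (sym k≡c)) c<k))
        where
        c = proj₁ inner
        c∈ = proj₁ (proj₂ inner)
        i<c = proj₁ (proj₂ (proj₂ inner))
        c<j = proj₂ (proj₂ (proj₂ inner))
        only : ∀ k → k ∈ S → toℕ i < toℕ k → toℕ k < toℕ j → ¬ k ≢ c
        only k k∈ i<k k<j k≢c = <⇒≱ (length≤∣p∣ {xs = i ∷ c ∷ j ∷ k ∷ []}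
          ((toℕ<⇒≢ i<c ∷ toℕ<⇒≢ i<j ∷ toℕ<⇒≢ i<k ∷ []) ∷ (toℕ<⇒≢ c<j ∷ (k≢c ∘ sym) ∷ []) ∷ ((toℕ<⇒≢ k<j ∘ sym) ∷ []) ∷ [] ∷ [])
          (i∈ ∷ c∈ ∷ j∈ ∷ k∈ ∷ [])) (≤-reflexive (proj₂ (proj₂ D-tri) S S-region))

    module ToTree {D : SegmentSet} (D-tri : Triangulation D) where
      private
        dg = proj₁ D-tri
        nc = proj₁ (proj₂ D-tri)

      record Subtree (i j : Vertex) : Set where
        field
          tree   : Tree
          ends   : toℕ i + leaves tree ≡ toℕ j
          sound′ : ∀ {x y} → Edge (toℕ i) tree (toℕ x) (toℕ y) → SideOrIn D x y
          full′  : ∀ {x y} → Contains D x y → toℕ i ≤ toℕ x → toℕ y ≤ toℕ j → Edge (toℕ i) tree (toℕ x) (toℕ y)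
      open Subtree

      -- Sides of the polygon are allowed: between adjacent vertices there is no room for `x`, and
      -- after the last vertex none for `y`.
      no-cross : ∀ {i c x y : Vertex} → SideOrIn D i c → Contains D x y →
        toℕ i < toℕ x → toℕ x < toℕ c → ¬ toℕ c < toℕ y
      no-cross (inj₂ ic) xy p q r = nc _ _ ic _ _ xy (inj₁ (p , q , r))
      no-cross (inj₁ (_ , inj₁ c≡)) xy p q r = <⇒≱ p (s≤s⁻¹ (subst (_ <_) c≡ q))
      no-cross {y = y} (inj₁ (_ , inj₂ (_ , c≡))) xy p q r = <⇒≱ (toℕ<n y) (subst (_≤ toℕ y) c≡ r)

      no-cross′ : ∀ {c j x y : Vertex} → SideOrIn D c j → Contains D x y →
        toℕ x < toℕ c → toℕ c < toℕ y → ¬ toℕ y < toℕ j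
      no-cross′ (inj₂ cj) xy p q r = nc _ _ cj _ _ xy (inj₂ (p , q , r))
      no-cross′ (inj₁ (_ , inj₁ j≡)) xy p q r = <⇒≱ q (s≤s⁻¹ (subst (_ <_) j≡ r))
      no-cross′ (inj₁ (_ , inj₂ (c≡ , _))) xy p q r = n≮0 (subst (_ <_) c≡ p)

      -- Recursion on a bound `d` for the distance from `i` to `j`, which drops for both halves
      -- because the apex lies strictly between.
      subtree : ∀ d i j → toℕ j ≤ toℕ i + d → SideOrIn D i j → Subtree i j
      subtree zero i j j≤ ij = contradiction (subst (toℕ j ≤_) (+-identityʳ _) j≤) (<⇒≱ (SideOrIn-< {D} dg ij))
      subtree (suc d) i j j≤ ij with m≤n⇒m<n∨m≡n (SideOrIn-< {D} dg ij)
      ... | inj₂ 1+i≡j = record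
        { tree   = leaf
        ; ends   = trans (+-comm (toℕ i) 1) 1+i≡j
        ; sound′ = λ ()
        ; full′  = λ {x} {y} xy i≤x y≤j → contradiction
            (proj₁ (dg x y xy) , inj₁ (≤-antisym (≤-trans y≤j (≤-trans (≤-reflexive (sym 1+i≡j)) (s≤s i≤x))) (proj₁ (dg x y xy))))
            (proj₂ (dg x y xy))
        }
      ... | inj₁ 1+i<j with BelowEdge.apexVertex D-tri 1+i<j ij
      ...   | c , i<c , c<j , ic , cj = record
        { tree = node (tree l) (tree r) ; ends = ends-eq ; sound′ = sound-node ; full′ = full-node }
        where
        l : Subtree i c
        l = subtree d i c (s≤s⁻¹ (≤-trans c<j (subst (toℕ j ≤_) (+-suc (toℕ i) d) j≤))) ic
        r : Subtree c j
        r = subtree d c j (≤-trans j≤ (subst (_≤ toℕ c + d) (sym (+-suc (toℕ i) d)) (+-monoˡ-≤ d i<c))) cj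
        ends-eq : toℕ i + (leaves (tree l) + leaves (tree r)) ≡ toℕ j
        ends-eq = trans (sym (+-assoc (toℕ i) _ _)) (trans (cong (_+ leaves (tree r)) (ends l)) (ends r))
        sound-node : ∀ {x y} → Edge (toℕ i) (node (tree l) (tree r)) (toℕ x) (toℕ y) → SideOrIn D x y
        sound-node (root p q) with refl ← toℕ-injective p | refl ← toℕ-injective (trans q ends-eq) = ij
        sound-node (left e)   = sound′ l e
        sound-node {x} {y} (right e) = sound′ r (subst (λ z → Edge z (tree r) (toℕ x) (toℕ y)) (ends l) e)
        full-node : ∀ {x y} → Contains D x y → toℕ i ≤ toℕ x → toℕ y ≤ toℕ j →
          Edge (toℕ i) (node (tree l) (tree r)) (toℕ x) (toℕ y)
        full-node {x} {y} xy i≤x y≤j with toℕ y ≤ℕ? toℕ c | toℕ c ≤ℕ? toℕ x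
        ... | yes y≤c | _ = left (full′ l xy i≤x y≤c)
        ... | _ | yes c≤x = right (subst (λ z → Edge z (tree r) (toℕ x) (toℕ y)) (sym (ends l)) (full′ r xy c≤x y≤j))
        -- A member passing over `c` must be `i j` itself; otherwise it would cross `i c` or `c j`.
        ... | no y≰c | no c≰x = root
          (≤-antisym (≮⇒≥ λ i<x → no-cross ic xy i<x (≰⇒> c≰x) (≰⇒> y≰c)) i≤x)
          (trans (≤-antisym y≤j (≮⇒≥ λ y<j → no-cross′ cj xy (≰⇒> c≰x) (≰⇒> y≰c) y<j)) (sym ends-eq))

    toTree : ∀ {D} → 2 ≤ n → Triangulation D → ∃ (Represents D)
    toTree {D} 2≤n D-tri = tree s , represents size′ sound″ full″
      where
      open ToTree D-tri
      open Subtree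
      dg = proj₁ D-tri
      0<n : 0 < n
      0<n = ≤-trans (s≤s z≤n) 2≤n
      last<n : pred n < n
      last<n = ≤-reflexive (suc-pred n {{>-nonZero 0<n}})
      first last : Vertex
      first = fromℕ< 0<n
      last  = fromℕ< last<n
      first≡ : toℕ first ≡ 0
      first≡ = toℕ-fromℕ< 0<n
      last≡ : suc (toℕ last) ≡ n
      last≡ = trans (cong suc (toℕ-fromℕ< last<n)) (suc-pred n {{>-nonZero 0<n}})
      first<last : toℕ first < toℕ last
      first<last = subst (_< toℕ last) (sym first≡) (s≤s⁻¹ (subst (2 ≤_) (sym last≡) 2≤n))
      s : Subtree first last
      -- The recursion starts from the rooting side, which thereby becomes the root.
      s = subtree (toℕ last) first last (m≤n+m _ (toℕ first)) (inj₁ (first<last , inj₂ (first≡ , last≡)))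
      size′ : suc (leaves (tree s)) ≡ n
      size′ = trans (cong suc (trans (cong (_+ leaves (tree s)) (sym first≡)) (ends s))) last≡
      sound″ : ∀ {i j} → Contains D i j → Chord (tree s) (toℕ i) (toℕ j)
      sound″ {i} {j} ij with Edge⇒Chord (tree s) (subst (λ z → Edge z (tree s) (toℕ i) (toℕ j)) first≡
        (full′ s ij (subst (_≤ toℕ i) (sym first≡) z≤n) (s≤s⁻¹ (subst (toℕ j <_) (sym last≡) (toℕ<n j)))))
      ... | inj₂ c = c
      ... | inj₁ (p , q) = contradiction (proj₁ (dg i j ij) , inj₂ (p , trans (cong suc q) size′)) (proj₂ (dg i j ij))
      full″ : ∀ {i j} → Chord (tree s) (toℕ i) (toℕ j) → Contains D i j
      full″ {i} {j} c with sound′ s (subst (λ z → Edge z (tree s) (toℕ i) (toℕ j)) (sym first≡) (Chord⇒Edge {tree s} c))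
      ... | inj₂ ij = ij
      ... | inj₁ (_ , inj₁ p) = contradiction (Edge-long (tree s) (Chord⇒Edge {tree s} c)) (<-irrefl (sym p))
      ... | inj₁ (_ , inj₂ (p , q)) =
        contradiction (subst₂ (Chord (tree s)) p (suc-injective (trans q (sym size′))) c) (Chord-no-root (tree s))

-- From disjoint triangulations to avoiders, and from internal triangles to triangles of chords.

module Counting where

  open Forests using (Tree; leaf; node; leaves; width; numAvoiders; avoiders)
  open Cores
  open Avoiders
  open Triangulations
  open import Data.Nat.Base hiding (∣_-_∣)
  open import Data.Nat.Properties hiding (_≟_; _<?_; _≤?_)
  open import Data.Fin.Base using (Fin; zero; suc; toℕ; fromℕ<; remQuot)
  open import Data.Fin.Properties using (toℕ-injective; toℕ-fromℕ<; combine-remQuot; remQuot-combine)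
  open import Data.Fin.Subset using (Subset; inside; outside; _∈_; _∪_; ⁅_⁆; ∣_∣)
  open import Data.Fin.Subset.Properties using (x∈⁅x⁆; x∈⁅y⁆⇒x≡y; x∈p∪q⁺; x∈p∪q⁻; x∈p∩q⁺; x∈p∩q⁻; ⊆-antisym)
  open import Data.List.Base using (List; []; _∷_; map; filter)
  open import Data.List.Properties using (length-map)
  open import Data.List.Membership.Propositional using () renaming (_∈_ to _∈ₗ_)
  open import Data.List.Membership.Propositional.Properties using (∈-map⁺; ∈-map⁻; ∈-++⁺ˡ; ∈-++⁺ʳ; ∈-filter⁺; ∈-filter⁻)
  open import Data.List.Membership.Propositional.Properties.WithK using (unique∧set⇒bag)
  open import Data.List.Relation.Binary.BagAndSetEquality using (∼bag⇒↭)
  open import Data.List.Relation.Binary.Permutation.Propositional.Properties using (↭-length)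
  open import Data.List.Relation.Unary.All as All using (All; []; _∷_)
  open import Data.List.Relation.Unary.Any using (here; there)
  open import Data.List.Relation.Unary.AllPairs using (AllPairs; []; _∷_)
  import Data.List.Relation.Unary.AllPairs.Properties as AllPairsₚ
  open import Data.List.Relation.Unary.Unique.Propositional using (Unique)
  import Data.List.Relation.Unary.Unique.Propositional.Properties as Uniqueₚ
  open import Data.Product.Base using (_×_; _,_; proj₁; proj₂; ∃)
  open import Data.Sum.Base using (_⊎_; inj₁; inj₂)
  import Data.Vec.Base as Vec
  open import Data.Vec.Properties using (∷-injectiveʳ)
  open import Function.Base using (_∘_)
  open import Function.Bundles using (_⇔_; mk⇔; module Equivalence)
  open import Relation.Nullary.Decidable using (_×-dec_)
  open import Relation.Nullary.Negation.Core using (¬_; contradiction)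
  open import Relation.Unary using (Decidable)
  open import Relation.Binary.PropositionalEquality hiding ([_])

  ∈-subsets : ∀ {m} (p : Subset m) → p ∈ₗ subsets m
  ∈-subsets Vec.[]              = here refl
  ∈-subsets (inside  Vec.∷ p)   = ∈-++⁺ˡ (∈-map⁺ _ (∈-subsets p))
  ∈-subsets {suc m} (outside Vec.∷ p) = ∈-++⁺ʳ (map (inside Vec.∷_) (subsets m)) (∈-map⁺ _ (∈-subsets p))

  subsets-unique : ∀ m → Unique (subsets m)
  subsets-unique zero    = [] ∷ []
  subsets-unique (suc m) = Uniqueₚ.++⁺
    (Uniqueₚ.map⁺ ∷-injectiveʳ (subsets-unique m)) (Uniqueₚ.map⁺ ∷-injectiveʳ (subsets-unique m))
    (λ (p∈ , q∈) → clash (∈-map⁻ _ p∈) (∈-map⁻ _ q∈))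
    where
    clash : ∀ {v} → (∃ λ p → p ∈ₗ subsets m × v ≡ inside Vec.∷ p) → ¬ (∃ λ q → q ∈ₗ subsets m × v ≡ outside Vec.∷ q)
    clash (_ , _ , refl) (_ , _ , ())

  unique-map-local : ∀ {A B : Set} (f : A → B) {P : A → Set} {xs} → (∀ {x y} → P x → P y → f x ≡ f y → x ≡ y) →
    All P xs → Unique xs → Unique (map f xs)
  unique-map-local f {P} inj Ps u = AllPairsₚ.map⁺ (go Ps u)
    where
    go : ∀ {xs} → All P xs → Unique xs → AllPairs (λ x y → f x ≢ f y) xs
    go []       []       = []
    go (p ∷ ps) (x∉ ∷ u) = All.zipWith (λ (q , x≢y) → x≢y ∘ inj p q) (ps , x∉) ∷ go ps u

  width-children : ∀ t → 2 ≤ leaves t → width (children t) ≡ leaves t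
  width-children leaf       (s≤s ())
  width-children (node l r) _ = cong (leaves l +_) (+-identityʳ _)

  module _ (n : ℕ) (3≤n : 3 ≤ n) where
    open Polygon n

    source target : Fin (n * n) → Vertex
    source q = proj₁ (remQuot {n} n q)
    target q = proj₂ (remQuot {n} n q)

    chordAt? : ∀ t → Decidable (λ q → Chord t (toℕ (source q)) (toℕ (target q)))
    chordAt? t q = ForestEdge? 0 (children t) (toℕ (source q)) (toℕ (target q))

    toSet : Tree → SegmentSet
    toSet t = fromPred (chordAt? t)

    toSet-represents : ∀ t → suc (leaves t) ≡ n → Represents n (toSet t) t
    toSet-represents t size = represents size
      (λ {i} {j} c → subst (λ (i , j) → Chord t (toℕ i) (toℕ j)) (remQuot-combine {n} i j) (∈-fromPred⁻ (chordAt? t) c))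
      (λ {i} {j} c → ∈-fromPred⁺ (chordAt? t) (subst (λ (i , j) → Chord t (toℕ i) (toℕ j)) (sym (remQuot-combine {n} i j)) c))

    ∈⇒Contains : ∀ D {q} → q ∈ D → Contains D (source q) (target q)
    ∈⇒Contains D {q} = subst (_∈ D) (sym (combine-remQuot {n} n q))

    SegmentSet-ext : ∀ {D D′} → (∀ i j → Contains D i j → Contains D′ i j) → (∀ i j → Contains D′ i j → Contains D i j) → D ≡ D′
    SegmentSet-ext {D} {D′} f f′ = ⊆-antisym (go f) (go f′)
      where
      go : ∀ {D D′} → (∀ i j → Contains D i j → Contains D′ i j) → ∀ {q} → q ∈ D → q ∈ D′
      go {D} {D′} f {q} q∈ = subst (_∈ D′) (combine-remQuot {n} n q) (f (source q) (target q) (∈⇒Contains D q∈))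

    represented-unique : ∀ {D D′ t} → Represents n D t → Represents n D′ t → D ≡ D′
    represented-unique R R′ = SegmentSet-ext (λ _ _ → full R′ ∘ sound R) (λ _ _ → full R ∘ sound R′)
      where open Represents

    chord-vertices : ∀ {D t x y} → Represents n D t → Chord t x y →
      ∃ λ i → ∃ λ j → x ≡ toℕ i × y ≡ toℕ j × Contains D i j
    chord-vertices {D} {t} {x} {y} R c = fromℕ< x<n , fromℕ< y<n , x≡ , y≡ , full R (subst₂ (Chord t) x≡ y≡ c)
      where
      open Represents
      e = Chord⇒Edge {t} c
      y<n : y < n
      y<n = subst (y <_) (size R) (s≤s (Edge-≤ t e))
      x<n : x < n
      x<n = <-trans (Edge-< t e) y<n
      x≡ = sym (toℕ-fromℕ< x<n)
      y≡ = sym (toℕ-fromℕ< y<n)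

    -- The chords agree because `D` determines them. The roots are not in `D`, but they agree
    -- because the sizes do.
    represents-injective : ∀ {D t t′} → Represents n D t → Represents n D t′ → t ≡ t′
    represents-injective {D} {t} {t′} R R′ = tree-ext 0 t t′ leaves≡ (go R R′ leaves≡) (go R′ R (sym leaves≡))
      where
      open Represents
      leaves≡ : leaves t ≡ leaves t′
      leaves≡ = suc-injective (trans (size R) (sym (size R′)))
      go : ∀ {t t′ x y} → Represents n D t → Represents n D t′ → leaves t ≡ leaves t′ → Edge 0 t x y → Edge 0 t′ x y
      go {t} {t′} R R′ lv e with Edge⇒Chord t e
      ... | inj₂ c with _ , _ , refl , refl , ij ← chord-vertices R c = Chord⇒Edge {t′} (sound R′ ij)
      go {t} {t′} R R′ lv e | inj₁ (refl , refl) with root-side 0 t′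
      ... | inj₁ p = contradiction (≤-trans (Edge-long t e) (≤-reflexive lv)) (<-irrefl p)
      ... | inj₂ e′ = subst (Edge 0 t′ 0) (sym lv) e′

    module _ {T : SegmentSet} {t : Tree} (R : Represents n T t) where
      open Represents

      private
        2≤leaves : 2 ≤ leaves t
        2≤leaves = s≤s⁻¹ (subst (3 ≤_) (sym (size R)) 3≤n)

        w = width (children t)

        w≡ : w ≡ leaves t
        w≡ = width-children t 2≤leaves

        2≤n : 2 ≤ n
        2≤n = ≤-trans (s≤s (s≤s z≤n)) 3≤n

        candidates : List Tree
        candidates = avoiders w (children t)

        good? : Decidable (λ U → Triangulation U × Disjoint T U)
        good? U = triangulation? U ×-dec disjoint? T U

        candidate-size : ∀ {u} → u ∈ₗ candidates → suc (leaves u) ≡ n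
        candidate-size u∈ = trans (cong suc (trans (avoiders-leaves w (children t) u∈) w≡)) (size R)

        to : ∀ {U} → U ∈ₗ filter good? (subsets (n * n)) → U ∈ₗ map toSet candidates
        to {U} U∈ with ∈-filter⁻ good? {xs = subsets (n * n)} U∈
        ... | _ , U-tri , disj with toTree n 2≤n U-tri
        ... | u , R′ = subst (_∈ₗ map toSet candidates) (represented-unique (toSet-represents u (size R′)) R′)
          (∈-map⁺ toSet (avoiders-complete w 0 (children t) ≤-refl u leaves≡ avoids))
          where
          leaves≡ : leaves u ≡ w
          leaves≡ = trans (suc-injective (trans (size R′) (sym (size R)))) (sym w≡)
          avoids : Avoids 0 u (children t)
          avoids e c with Edge⇒Chord u e
          -- The root of `u` is not a member of `U`, so disjointness says nothing here; no chord of
          -- `t` has this span.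
          ... | inj₁ (refl , refl) = Chord-no-root t (subst (Chord t 0) (trans leaves≡ w≡) c)
          ... | inj₂ c′ with _ , _ , refl , refl , ij ← chord-vertices R c = disj (_ , x∈p∩q⁺ (ij , full R′ c′))

        from : ∀ {U} → U ∈ₗ map toSet candidates → U ∈ₗ filter good? (subsets (n * n))
        from U∈ with u , u∈ , refl ← ∈-map⁻ toSet U∈ =
          ∈-filter⁺ good? (∈-subsets _) (FromTree.triangulation n R′ , disj)
          where
          R′ = toSet-represents u (candidate-size u∈)
          disj : Disjoint T (toSet u)
          disj (q , q∈) with q∈T , q∈U ← x∈p∩q⁻ T (toSet u) q∈ = avoiders-sound w 0 (children t) u∈
            (Chord⇒Edge {u} (sound R′ {source q} {target q} (∈⇒Contains (toSet u) q∈U)))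
            (sound R {source q} {target q} (∈⇒Contains T q∈T))

      -- Two lists without repetitions and with the same members have equal length. The members
      -- agree because disjointness from `T` is avoidance of the children of `t`.
      count : numDisjointTriangulations T ≡ numAvoiders (children t)
      count = trans (↭-length (∼bag⇒↭ (unique∧set⇒bag
          (Uniqueₚ.filter⁺ good? (subsets-unique (n * n)))
          (unique-map-local toSet {P = λ u → suc (leaves u) ≡ n}
            (λ {u} {u′} p p′ e → represents-injective (toSet-represents u p)
              (subst (λ D → Represents n D u′) (sym e) (toSet-represents u′ p′)))
            (All.tabulate candidate-size) (avoiders-unique w (children t)))
          (mk⇔ to from))))
        (length-map toSet candidates)

    module _ {i k j : Vertex} (i<k : toℕ i < toℕ k) (k<j : toℕ k < toℕ j) where

      triple : Subset n
      triple = ⁅ i ⁆ ∪ ⁅ k ⁆ ∪ ⁅ j ⁆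

      private
        i<j = <-trans i<k k<j

        i∈ : i ∈ triple
        i∈ = x∈p∪q⁺ (inj₁ (x∈⁅x⁆ i))
        k∈ : k ∈ triple
        k∈ = x∈p∪q⁺ {p = ⁅ i ⁆} (inj₂ (x∈p∪q⁺ (inj₁ (x∈⁅x⁆ k))))
        j∈ : j ∈ triple
        j∈ = x∈p∪q⁺ {p = ⁅ i ⁆} (inj₂ (x∈p∪q⁺ {p = ⁅ k ⁆} (inj₂ (x∈⁅x⁆ j))))

        members : ∀ {z} → z ∈ triple → z ∈ₗ i ∷ k ∷ j ∷ []
        members z∈ with x∈p∪q⁻ ⁅ i ⁆ (⁅ k ⁆ ∪ ⁅ j ⁆) z∈
        ... | inj₁ p = here (x∈⁅y⁆⇒x≡y i p)
        ... | inj₂ p with x∈p∪q⁻ ⁅ k ⁆ ⁅ j ⁆ p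
        ...   | inj₁ q = there (here (x∈⁅y⁆⇒x≡y k q))
        ...   | inj₂ q = there (there (here (x∈⁅y⁆⇒x≡y j q)))


        size-triple : ∣ triple ∣ ≡ 3
        size-triple = ≤-antisym (∣p∣≤length (i ∷ k ∷ j ∷ []) triple members)
          (length≤∣p∣ {xs = i ∷ k ∷ j ∷ []} ((toℕ<⇒≢ i<k ∷ toℕ<⇒≢ i<j ∷ []) ∷ (toℕ<⇒≢ k<j ∷ []) ∷ [] ∷ []) (i∈ ∷ k∈ ∷ j∈ ∷ []))

        ik-consecutive : Consecutive triple i k
        ik-consecutive = inj₁ λ z z∈ (p , q) → case (members z∈) p q
          where
          case : ∀ {z} → z ∈ₗ i ∷ k ∷ j ∷ [] → toℕ i < toℕ z → ¬ toℕ z < toℕ k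
          case (here refl) p q = <-irrefl refl p
          case (there (here refl)) p q = <-irrefl refl q
          case (there (there (here refl))) p q = <-asym q k<j

        kj-consecutive : Consecutive triple k j
        kj-consecutive = inj₁ λ z z∈ (p , q) → case (members z∈) p q
          where
          case : ∀ {z} → z ∈ₗ i ∷ k ∷ j ∷ [] → toℕ k < toℕ z → ¬ toℕ z < toℕ j
          case (here refl) p q = <-asym p i<k
          case (there (here refl)) p q = <-irrefl refl p
          case (there (there (here refl))) p q = <-irrefl refl q

        ij-consecutive : Consecutive triple i j
        ij-consecutive = inj₂ λ z z∈ → case (members z∈)
          where
          case : ∀ {z} → z ∈ₗ i ∷ k ∷ j ∷ [] → ¬ (toℕ z < toℕ i ⊎ toℕ j < toℕ z)
          case (here refl) (inj₁ p) = <-irrefl refl p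
          case (here refl) (inj₂ p) = <-asym p i<j
          case (there (here refl)) (inj₁ p) = <-asym p i<k
          case (there (here refl)) (inj₂ p) = <-asym p k<j
          case (there (there (here refl))) (inj₁ p) = <-asym p i<j
          case (there (there (here refl))) (inj₂ p) = <-irrefl refl p

        elim : (Q : Vertex → Vertex → Set) → Q i k → Q k j → Q i j →
          ∀ {x y} → x ∈ triple → y ∈ triple → toℕ x < toℕ y → Q x y
        elim Q ik kj ij x∈ y∈ x<y with members x∈ | members y∈
        ... | here refl                 | here refl                 = contradiction x<y (<-irrefl refl)
        ... | here refl                 | there (here refl)         = ik
        ... | here refl                 | there (there (here refl)) = ij
        ... | there (here refl)         | here refl                 = contradiction x<y (<-asym i<k)
        ... | there (here refl)         | there (here refl)         = contradiction x<y (<-irrefl refl)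
        ... | there (here refl)         | there (there (here refl)) = kj
        ... | there (there (here refl)) | here refl                 = contradiction x<y (<-asym i<j)
        ... | there (there (here refl)) | there (here refl)         = contradiction x<y (<-asym k<j)
        ... | there (there (here refl)) | there (there (here refl)) = contradiction x<y (<-irrefl refl)

      internal⁺ : ∀ {D} → AllDiagonals D → Contains D i k → Contains D k j → Contains D i j → InternalTriangle D triple
      internal⁺ {D} dg ik kj ij =
        (≤-reflexive (sym size-triple) ,
          λ x x∈ y y∈ x<y → (λ _ → inj₂ (contains x∈ y∈ x<y)) ,
            (λ _ → elim (Consecutive triple) ik-consecutive kj-consecutive ij-consecutive x∈ y∈ x<y)) ,
        size-triple ,
        λ x x∈ y y∈ s → proj₂ (dg x y (contains x∈ y∈ (proj₁ s))) s
        where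
        contains : ∀ {x y} → x ∈ triple → y ∈ triple → toℕ x < toℕ y → Contains D x y
        contains = elim (Contains D) ik kj ij

      internal⁻ : ∀ {D} → InternalTriangle D triple → Contains D i k × Contains D k j × Contains D i j
      internal⁻ {D} ((_ , region) , _ , noSide) =
        get i∈ k∈ i<k ik-consecutive , get k∈ j∈ k<j kj-consecutive , get i∈ j∈ i<j ij-consecutive
        where
        get : ∀ {x y} → x ∈ triple → y ∈ triple → toℕ x < toℕ y → Consecutive triple x y → Contains D x y
        get x∈ y∈ x<y c with proj₁ (region _ x∈ _ y∈ x<y) c
        ... | inj₁ s = contradiction s (noSide _ x∈ _ y∈)
        ... | inj₂ d = d

    -- An internal triangle has no side of the polygon among its edges, so it amounts to three
    -- diagonals that join three vertices pairwise. This carries the hypothesis on vertex sets over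
    -- to the trees.
    triangles-⊆ : ∀ {T T′ t t′} → Represents n T t → Represents n T′ t′ →
      (∀ S → InternalTriangle T S → InternalTriangle T′ S) →
      ∀ {x k y} → Triangle (Chord t) x k y → Triangle (Chord t′) x k y
    triangles-⊆ {T} {T′} {t} R R′ f {x} {k} {y} (xk , ky , xy)
      with a , b , refl , refl , ab ← chord-vertices {T} {t} R xk
      with b′ , c , b≡b′ , refl , bc ← chord-vertices {T} {t} {x = k} R ky
      = go (toℕ-injective b≡b′)
      where
      open Represents
      go : b ≡ b′ → _
      go refl = sound R′ p , sound R′ q , sound R′ r
        where
        b<c = Edge-< t (Chord⇒Edge {t} ky)
        a<b = Edge-< t (Chord⇒Edge {t} xk)
        all = internal⁻ a<b b<c {T′} (f (triple a<b b<c) (internal⁺ a<b b<c (FromTree.allDiagonals n R) ab bc (full R xy)))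
        p = proj₁ all
        q = proj₁ (proj₂ all)
        r = proj₂ (proj₂ all)

open import Data.Nat.Base using (s≤s; z≤n)
open import Data.Nat.Properties using (≤-trans; n≤1+n; suc-injective)
open import Data.Product.Base using (_,_)
open import Function.Bundles using (module Equivalence)
open import Relation.Binary.PropositionalEquality.Core using (trans; sym)
open Cores using (numAvoiders-triangles)
open Triangulations using (module Represents; toTree)
open Counting using (count; triangles-⊆)

theorem3p3 : (n : ℕ) → 4 ≤ n → let open Polygon n in
    (T₁ T₂ : SegmentSet) → Triangulation T₁ → Triangulation T₂ →
    ((S : Subset n) → InternalTriangle T₁ S ⇔ InternalTriangle T₂ S) →
    numDisjointTriangulations T₁ ≡ numDisjointTriangulations T₂
theorem3p3 n 4≤n T₁ T₂ tri₁ tri₂ same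
  with t₁ , R₁ ← toTree n (≤-trans (s≤s (s≤s z≤n)) 4≤n) tri₁
  with t₂ , R₂ ← toTree n (≤-trans (s≤s (s≤s z≤n)) 4≤n) tri₂ =
  trans (count n 3≤n R₁) (trans
    (numAvoiders-triangles t₁ t₂ (suc-injective (trans (Represents.size R₁) (sym (Represents.size R₂))))
      (triangles-⊆ n 3≤n R₁ R₂ (λ S → Equivalence.to (same S)))
      (triangles-⊆ n 3≤n R₂ R₁ (λ S → Equivalence.from (same S))))
    (sym (count n 3≤n R₂)))
  where
  3≤n : 3 ≤ n
  3≤n = ≤-trans (n≤1+n 3) 4≤n
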